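{- Let $q=2^r$ with $r\geq 3$, let $n=2^s$ with $s\in\mathbb{Z}_{>0}$, and put $N_1=(q-1)^{n-1}$. Then for every $h=1,2,\dots$, \[ MK_{n-1}^{h}=\sum_{l=0}^{h-1}(-1)^{h+l+1}\binom{h}{l}(q-1)^{(n-1)(h-l)}MK_{n-1}^{l} +q\sum_{j=0}^{\min\{(q-1)^{n-1},h\}}(-1)^{h+j}C_{n-1,j}\sum_{t=j}^{h}t!\,S(h,t)\,2^{h-t}\binom{(q-1)^{n-1}-j}{(q-1)^{n-1}-t}. \] Moreover, the weight distribution of $C_{n-1}$ is given by \[ C_{n-1,j}=\sum\prod_{\beta\in\mathbb{F}_q}\binom{\delta(n-1,q;\beta)}{\nu_\beta}, \] where the sum runs over all families of integers $\{\nu_\beta\}_{\beta\in\mathbb{F}_q}$ with $0\le\nu_\beta\le\delta(n-1,q;\beta)$, $\sum_{\beta\in\mathbb{F}_q}\nu_\beta=j$ and $\sum_{\beta\in\mathbb{F}_q}\nu_\beta\beta=0$ (the latter an identity in $\mathbb{F}_q$). Here \[ \delta(n-1,q;\beta)=|\{(\alpha_1,\dots,\alpha_{n-1})\in(\mathbb{F}_q^*)^{n-1}:\alpha_1+\cdots+\alpha_{n-1}+\alpha_1^{ -1}\cdots\alpha_{n-1}^{ -1}=\beta\}|, \] which equals $q^{ -1}\{(q-1)^{n-1}+1\}$ if $\beta=0$ and $K_{n-2}(\lambda;\beta^{ -1})+q^{ -1}\{(q-1)^{n-1}+1\}$ if $\beta\in\mathbb{F}_q^*$.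
   Context: $\mathbb{F}_q$ is the finite field with $q=2^r$ elements, $tr:\mathbb{F}_q\to\mathbb{F}_2$, $tr(x)=x+x^2+\cdots+x^{2^{r-1}}$, and $\lambda(x)=(-1)^{tr(x)}$ is the canonical additive character. For $m\ge1$ and $a\in\mathbb{F}_q^*$, the $m$-dimensional Kloosterman sum is $K_m(\lambda;a)=\sum_{\alpha_1,\dots,\alpha_m\in\mathbb{F}_q^*}\lambda(\alpha_1+\cdots+\alpha_m+a\alpha_1^{ -1}\cdots\alpha_m^{ -1})$; by convention $K_0(\lambda;a)=\lambda(a)$. For $h\ge0$, $MK_m^h=\sum_{a\in\mathbb{F}_q^*}K_m(\lambda;a)^h$. $S(h,t)=\frac{1}{t!}\sum_{j=0}^{t}(-1)^{t-j}\binom{t}{j}j^h$ is the Stirling number of the second kind. Fix an ordering of $(\mathbb{F}_q^*)^{n-1}$ and let $v_{n-1}=(g_1,\dots,g_{N_1})\in\mathbb{F}_q^{N_1}$, where $g_i=\alpha_1+\cdots+\alpha_{n-1}+\alpha_1^{ -1}\cdots\alpha_{n-1}^{ -1}$ for the $i$-th tuple $(\alpha_1,\dots,\alpha_{n-1})$. The binary linear code $C_{n-1}$ is $\{u\in\mathbb{F}_2^{N_1}:\sum_{i}u_ig_i=0 \text{ in } \mathbb{F}_q\}$, and $C_{n-1,j}$ denotes the number of codewords of Hamming weight $j$ in $C_{n-1}$. -}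

module Defs where

open import Level using (0ℓ)
open import Data.Bool using (Bool; true; false; if_then_else_)
open import Data.Nat as ℕ using (ℕ; zero; suc; _∸_; _⊓_)
open import Data.Nat.Properties using (_!≢0)
open import Data.Nat.Combinatorics using (_C_)
open import Data.Nat.Base using (_!)
open import Data.Integer as ℤ using (ℤ; +_; -[1+_]; 0ℤ; 1ℤ; -1ℤ)
open import Data.List using (List; []; _∷_; [_]; map; foldr; concatMap; filter; length; upTo)
open import Data.Nat.ListAction using (sum; product)
open import Data.List.Membership.Propositional using (_∈_)
open import Data.List.Relation.Unary.Unique.Propositional using (Unique)
open import Data.Vec as Vec using (Vec; []; _∷_; fromList; toList)
open import Data.Product using (_×_; _,_)
open import Relation.Nullary using (¬?; does)
open import Relation.Nullary.Decidable using (_×-dec_)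
open import Relation.Binary.Definitions using (DecidableEquality)
open import Relation.Binary.PropositionalEquality using (_≡_; _≢_)
open import Algebra.Core using (Op₁; Op₂)
open import Algebra.Structures using (IsCommutativeRing)

-- A finite field, presented concretely: a commutative ring (with
-- propositional equality) in which 0 ≠ 1 and every nonzero element has
-- an inverse, with decidable equality and an explicit duplicate-free
-- list of all its elements.  The inverse is a total function; its value
-- at 0 is irrelevant (it is only ever applied to nonzero elements).

record FiniteField : Set₁ where
  infixl 6 _+_
  infixl 7 _*_
  field
    Carrier           : Set
    _+_ _*_           : Op₂ Carrier
    -_                : Op₁ Carrier
    0# 1#             : Carrier
    isCommutativeRing : IsCommutativeRing _≡_ _+_ _*_ -_ 0# 1#
    0≢1               : 0# ≢ 1#
    _⁻¹               : Op₁ Carrier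
    ⁻¹-inverse        : ∀ x → x ≢ 0# → x * (x ⁻¹) ≡ 1#
    _≟_               : DecidableEquality Carrier
    elements          : List Carrier
    elements-complete : ∀ x → x ∈ elements
    elements-unique   : Unique elements

sumℤ : List ℤ → ℤ
sumℤ = foldr ℤ._+_ 0ℤ

range : ℕ → ℕ → List ℕ
range a b = map (a ℕ.+_) (upTo (suc b ∸ a))

sgn : ℕ → ℤ
sgn k = -1ℤ ℤ.^ k

binomZ : ℕ → ℤ → ℕ
binomZ n (+ k)      = n C k
binomZ n -[1+ _ ]   = 0

-- Stirling number of the second kind, exactly as in the paper:
-- S(h,t) = (1/t!) Σ_{j=0}^{t} (-1)^{t-j} C(t,j) j^h   (the division is exact)
S : ℕ → ℕ → ℤ
S h t = (sumℤ (map (λ j → sgn (t ∸ j) ℤ.* + (t C j) ℤ.* + (j ℕ.^ h)) (range 0 t)) ℤ./ℕ (t !)) {{t !≢0}}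

module FF (F : FiniteField) where
  open FiniteField F

  pow : Carrier → ℕ → Carrier
  pow x zero    = 1#
  pow x (suc k) = x * pow x k

  nmul : ℕ → Carrier → Carrier
  nmul zero    b = 0#
  nmul (suc k) b = b + nmul k b

  sumF : List Carrier → Carrier
  sumF = foldr _+_ 0#

  prodF : List Carrier → Carrier
  prodF = foldr _*_ 1#

  tr : ℕ → Carrier → Carrier
  tr r x = sumF (map (λ i → pow x (2 ℕ.^ i)) (upTo r))

  -- canonical additive character λ(x) = (-1)^{tr(x)}  (tr(x) ∈ {0,1} ⊆ F)
  χ : ℕ → Carrier → ℤ
  χ r x = if does (tr r x ≟ 0#) then 1ℤ else -1ℤ

  nonzeros : List Carrier
  nonzeros = filter (λ x → ¬? (x ≟ 0#)) elements

  tuples : (m : ℕ) → List (Vec Carrier m)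
  tuples zero    = [ [] ]
  tuples (suc m) = concatMap (λ a → map (a ∷_) (tuples m)) nonzeros

  -- m-dimensional Kloosterman sum K_m(λ; a) (for m = 0 this is λ(a))
  K : ℕ → (m : ℕ) → Carrier → ℤ
  K r m a = sumℤ (map (λ α → χ r (sumF (toList α) + a * prodF (map _⁻¹ (toList α)))) (tuples m))

  MK : ℕ → ℕ → ℕ → ℤ
  MK r m h = sumℤ (map (λ a → K r m a ℤ.^ h) nonzeros)

  g : ∀ {m} → Vec Carrier m → Carrier
  g α = sumF (toList α) + prodF (map _⁻¹ (toList α))

  gs : ℕ → List Carrier
  gs m = map g (tuples m)

  boolVecs : (k : ℕ) → List (Vec Bool k)
  boolVecs zero    = [ [] ]
  boolVecs (suc k) = concatMap (λ b → map (b ∷_) (boolVecs k)) (true ∷ false ∷ [])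

  weight : ∀ {k} → Vec Bool k → ℕ
  weight []            = 0
  weight (true ∷ u)    = suc (weight u)
  weight (false ∷ u)   = weight u

  dot : ∀ {k} → Vec Bool k → Vec Carrier k → Carrier
  dot []          []       = 0#
  dot (true ∷ u)  (x ∷ v)  = x + dot u v
  dot (false ∷ u) (x ∷ v)  = dot u v

  Cw : ℕ → ℕ → ℕ
  Cw m j = length (filter (λ u → (weight u ℕ.≟ j) ×-dec (dot u (fromList (gs m)) ≟ 0#)) (boolVecs (length (gs m))))

  δ : ℕ → Carrier → ℕ
  δ m β = length (filter (λ α → g α ≟ β) (tuples m))

  families : ℕ → List Carrier → List (List (Carrier × ℕ))
  families m []       = [ [] ]
  families m (b ∷ bs) = concatMap (λ ν → map ((b , ν) ∷_) (families m bs)) (upTo (suc (δ m b)))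

  famSize : List (Carrier × ℕ) → ℕ
  famSize f = sum (map (λ { (b , ν) → ν }) f)

  famWeightedSum : List (Carrier × ℕ) → Carrier
  famWeightedSum f = sumF (map (λ { (b , ν) → nmul ν b }) f)

  CwFormula : ℕ → ℕ → ℕ
  CwFormula m j =
    sum (map (λ f → product (map (λ { (b , ν) → δ m b C ν }) f))
             (filter (λ f → (famSize f ℕ.≟ j) ×-dec (famWeightedSum f ≟ 0#)) (families m elements)))

  mkRHS : (r s h : ℕ) → ℤ
  mkRHS r s h =
    sumℤ (map (λ l → sgn (h ℕ.+ l ℕ.+ 1) ℤ.* + (h C l) ℤ.* + ((q ∸ 1) ℕ.^ ((n ∸ 1) ℕ.* (h ∸ l))) ℤ.* MK r (n ∸ 1) l)
              (upTo h))
    ℤ.+ + q ℤ.* sumℤ (map (λ j → sgn (h ℕ.+ j) ℤ.* + Cw (n ∸ 1) j ℤ.*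
              sumℤ (map (λ t → + (t !) ℤ.* S h t ℤ.* + (2 ℕ.^ (h ∸ t)) ℤ.* + binomZ (N₁ ∸ j) (+ N₁ ℤ.- + t))
                        (range j h)))
            (range 0 (N₁ ⊓ h)))
    where
      q n N₁ : ℕ
      q  = 2 ℕ.^ r
      n  = 2 ℕ.^ s
      N₁ = (q ∸ 1) ℕ.^ (n ∸ 1)

{-# OPTIONS --safe #-}
module Submission where

open import Defs
open import Level using (0ℓ)
open import Algebra.Bundles using (CommutativeRing)
import Algebra.Properties.Ring as RingProperties
import Algebra.Solver.Ring.NaturalCoefficients.Default as SemiringSolver
open import Algebra.Structures using (IsCommutativeSemiring)
open import Data.Bool using (true; false; if_then_else_)
open import Data.Empty using (⊥-elim)
open import Data.Nat as ℕ using (ℕ; zero; suc; _∸_; _⊓_; _≤_; _<_; z≤n; s≤s)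
open import Data.Nat.Base using (_!)
import Data.Nat.Properties as ℕₚ
open import Data.Nat.Properties using (_!≢0)
open import Data.Nat.Combinatorics using (_C_; nCn≡1; nCk≡nC[n∸k]; nCk+nC[k+1]≡[n+1]C[k+1])
open import Data.Nat.Combinatorics.Specification using (k>n⇒nCk≡0)
open import Data.Nat.DivMod using (m*n/n≡m)
open import Data.Nat.ListAction using (sum; product)
open import Data.Integer as ℤ using (ℤ; 0ℤ; 1ℤ; -1ℤ)
import Data.Integer.Properties as ℤₚ
open import Data.Integer.Tactic.RingSolver using (solve-∀)
open import Data.List using (List; []; _∷_; [_]; map; foldr; concatMap; filter; length; upTo; _++_)
open import Data.List.Properties using (map-id; map-∘; map-cong; map-applyUpTo; length-map; filter-accept; filter-reject)
open import Data.List.Membership.Propositional using (_∈_; find)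
open import Data.List.Membership.Propositional.Properties using (∈-upTo⁺; ∈-upTo⁻; ∈-map⁺; ∈-map⁻; ∈-filter⁺; ∈-filter⁻)
open import Data.List.Membership.Propositional.Properties.WithK using (unique∧set⇒bag)
open import Data.List.Relation.Binary.BagAndSetEquality using (∼bag⇒↭)
open import Data.List.Relation.Binary.Permutation.Propositional using (_↭_; ↭⇒↭ₛ)
open import Data.List.Relation.Binary.Permutation.Propositional.Properties using (map⁺; ↭-length)
open import Data.List.Relation.Binary.Permutation.Setoid.Properties using (foldr-commMonoid)
open import Data.List.Relation.Unary.All as All using (all?)
open import Data.List.Relation.Unary.All.Properties using (¬All⇒Any¬)
open import Data.List.Relation.Unary.AllPairs using ([]; _∷_)
open import Data.List.Relation.Unary.Any using (here; there)
open import Data.List.Relation.Unary.Unique.Propositional using (Unique)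
import Data.List.Relation.Unary.Unique.Propositional.Properties as Unique
open import Data.Product using (Σ-syntax; ∃; _×_; _,_; proj₁; proj₂)
open import Data.Sum using (_⊎_; inj₁; inj₂)
open import Data.Vec as Vec using (Vec; []; _∷_; toList; fromList)
import Data.Vec.Relation.Unary.All as VecAll
open import Function using (_∘_; id)
open import Function.Bundles using (mk⇔)
open import Relation.Binary.PropositionalEquality hiding ([_]; J)
open import Relation.Nullary using (Dec; yes; no; ¬_; ¬?; does)
open import Relation.Nullary.Decidable using (_×-dec_)
open import Relation.Unary using (Pred; Decidable)

-- Summing additive characters over F counts solutions of equations. Scaling all α by x
-- turns Σ ψ(x g(α)) into K_m(x^(m+1)), which is K_m(x) because m + 1 = 2^s and K_m is
-- Frobenius invariant; this gives δ. The power moments follow from the Pless identity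
-- for the words (tr(x gᵢ))ᵢ, whose weight w(x) satisfies N − K_m(x) = 2 w(x): expand w^h
-- by Newton's forward differences (which are t! S(h,t)), expand 2^t C(w(x), t) over
-- subsets, and sum over x, so that only codewords of C survive.

-- Indexing the words (tr(x gᵢ))ᵢ by x in F, with repetitions counted, lets orthogonality of
-- characters produce exactly the syndrome equation Σ uᵢ gᵢ = 0 in F; the moment identity is then a
-- double count. The hypothesis s ≥ 1 acts through parity: m = 2^s - 1 is odd, so the sum of ψ(α₁ +
-- ... + α_m) over nonzero tuples is (-1)^m = -1, and this becomes the +1 in the formula for δ. That
-- formula is kept multiplied by q, so everything stays in the integers. A field given by the list
-- of its elements supplies neither characteristic 2 nor a nontrivial character. The first is
-- extracted from the cardinality; the second comes from a degree bound, since the trace is a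
-- polynomial of degree q/2 and cannot vanish at q points. The weight distribution is a separate
-- argument without characters: the positions of a word are grouped by the value gᵢ, and counting by
-- words and counting by multiplicities obey the same recursion when one position is added.

unique-↭ : ∀ {A : Set} {xs ys : List A} → Unique xs → Unique ys →
  (∀ {x} → x ∈ xs → x ∈ ys) → (∀ {x} → x ∈ ys → x ∈ xs) → xs ↭ ys
unique-↭ uxs uys to from = ∼bag⇒↭ (unique∧set⇒bag uxs uys (mk⇔ to from))

upTo-suc : ∀ n → upTo (suc n) ≡ 0 ∷ map suc (upTo n)
upTo-suc n = cong (0 ∷_) (sym (map-applyUpTo id suc n))

-- Finite sums over a commutative semiring.

module Sum {A : Set} {_+_ _*_ : A → A → A} {0# 1# : A}
           (isCS : IsCommutativeSemiring _≡_ _+_ _*_ 0# 1#) where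
  open IsCommutativeSemiring isCS
    using (+-assoc; +-comm; +-identityˡ; +-identityʳ; *-identityˡ; zeroˡ; zeroʳ; distribˡ; *-comm; +-isCommutativeMonoid)
  open ≡-Reasoning

  private variable
    B C : Set

  +-interchange : ∀ a b c d → (a + b) + (c + d) ≡ (a + c) + (b + d)
  +-interchange a b c d = begin
    (a + b) + (c + d) ≡⟨ +-assoc a b _ ⟩
    a + (b + (c + d)) ≡⟨ cong (a +_) (sym (+-assoc b c d)) ⟩
    a + ((b + c) + d) ≡⟨ cong (λ z → a + (z + d)) (+-comm b c) ⟩
    a + ((c + b) + d) ≡⟨ cong (a +_) (+-assoc c b d) ⟩
    a + (c + (b + d)) ≡⟨ sym (+-assoc a c _) ⟩
    (a + c) + (b + d) ∎

  ind : {P : Set} → Dec P → A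
  ind (yes _) = 1#
  ind (no _)  = 0#

  ind-yes : {P : Set} (d : Dec P) → P → ind d ≡ 1#
  ind-yes (yes _) p = refl
  ind-yes (no ¬p) p = ⊥-elim (¬p p)

  ind-no : {P : Set} (d : Dec P) → ¬ P → ind d ≡ 0#
  ind-no (no _)  ¬p = refl
  ind-no (yes p) ¬p = ⊥-elim (¬p p)

  ind-cong : {P Q : Set} (d : Dec P) (e : Dec Q) → (P → Q) → (Q → P) → ind d ≡ ind e
  ind-cong (yes p) e to from = sym (ind-yes e (to p))
  ind-cong (no ¬p) e to from = sym (ind-no e (¬p ∘ from))

  -- Opaque so that the summand and the list can be inferred by unification.
  opaque
    Σ : {B : Set} → List B → (B → A) → A
    Σ L f = foldr _+_ 0# (map f L)

    Σ-def : {B : Set} (L : List B) (f : B → A) → Σ L f ≡ foldr _+_ 0# (map f L)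
    Σ-def L f = refl

    Σ-[] : {B : Set} {f : B → A} → Σ [] f ≡ 0#
    Σ-[] = refl

    Σ-∷ : ∀ {B : Set} (x : B) L {f : B → A} → Σ (x ∷ L) f ≡ f x + Σ L f
    Σ-∷ x L = refl

    Σ-singleton : ∀ {B : Set} (x : B) {f : B → A} → Σ [ x ] f ≡ f x
    Σ-singleton x {f} = +-identityʳ (f x)

    Σ-cong∈ : ∀ (L : List B) {f g : B → A} → (∀ {x} → x ∈ L → f x ≡ g x) → Σ L f ≡ Σ L g
    Σ-cong∈ []      e = refl
    Σ-cong∈ (x ∷ L) e = cong₂ _+_ (e (here refl)) (Σ-cong∈ L (e ∘ there))

    Σ-cong : ∀ (L : List B) {f g : B → A} → (∀ x → f x ≡ g x) → Σ L f ≡ Σ L g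
    Σ-cong L e = Σ-cong∈ L (λ {x} _ → e x)

    Σ-0 : ∀ (L : List B) {f : B → A} → (∀ {x} → x ∈ L → f x ≡ 0#) → Σ L f ≡ 0#
    Σ-0 []      e = refl
    Σ-0 (x ∷ L) e = trans (cong₂ _+_ (e (here refl)) (Σ-0 L (e ∘ there))) (+-identityˡ 0#)

    Σ-+ : ∀ (L : List B) (f g : B → A) → Σ L (λ x → f x + g x) ≡ Σ L f + Σ L g
    Σ-+ []      f g = sym (+-identityˡ 0#)
    Σ-+ (x ∷ L) f g = trans (cong ((f x + g x) +_) (Σ-+ L f g)) (+-interchange (f x) (g x) _ _)

    Σ-*ˡ : ∀ (L : List B) c (f : B → A) → Σ L (λ x → c * f x) ≡ c * Σ L f
    Σ-*ˡ []      c f = sym (zeroʳ c)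
    Σ-*ˡ (x ∷ L) c f = trans (cong ((c * f x) +_) (Σ-*ˡ L c f)) (sym (distribˡ c _ _))

    Σ-*ʳ : ∀ (L : List B) c (f : B → A) → Σ L (λ x → f x * c) ≡ Σ L f * c
    Σ-*ʳ L c f = trans (Σ-cong L (λ x → *-comm (f x) c)) (trans (Σ-*ˡ L c f) (*-comm c _))

    Σ-swap : ∀ (L : List B) (M : List C) (f : B → C → A) →
      Σ L (λ x → Σ M (f x)) ≡ Σ M (λ y → Σ L (λ x → f x y))
    Σ-swap []      M f = sym (Σ-0 M (λ _ → refl))
    Σ-swap (x ∷ L) M f = trans (cong (Σ M (f x) +_) (Σ-swap L M f)) (sym (Σ-+ M (f x) _))

    Σ-++ : ∀ (L M : List B) (f : B → A) → Σ (L ++ M) f ≡ Σ L f + Σ M f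
    Σ-++ []      M f = sym (+-identityˡ _)
    Σ-++ (x ∷ L) M f = trans (cong (f x +_) (Σ-++ L M f)) (sym (+-assoc (f x) _ _))

    Σ-map : ∀ (L : List B) (h : B → C) (f : C → A) → Σ (map h L) f ≡ Σ L (f ∘ h)
    Σ-map L h f = cong (foldr _+_ 0#) (sym (map-∘ L))

    Σ-concatMap : ∀ (L : List B) (h : B → List C) (f : C → A) → Σ (concatMap h L) f ≡ Σ L (λ x → Σ (h x) f)
    Σ-concatMap []      h f = refl
    Σ-concatMap (x ∷ L) h f = trans (Σ-++ (h x) (concatMap h L) f) (cong (Σ (h x) f +_) (Σ-concatMap L h f))

    Σ-↭ : ∀ {L M : List B} (f : B → A) → L ↭ M → Σ L f ≡ Σ M f
    Σ-↭ f p = foldr-commMonoid (setoid A) +-isCommutativeMonoid (↭⇒↭ₛ (map⁺ f p))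

    Σ-filter : ∀ {P : Pred B _} (P? : Decidable P) (L : List B) (f : B → A) →
      Σ (filter P? L) f ≡ Σ L (λ x → ind (P? x) * f x)
    Σ-filter P? []      f = refl
    Σ-filter P? (x ∷ L) f with P? x
    ... | yes _ = cong₂ _+_ (sym (*-identityˡ (f x))) (Σ-filter P? L f)
    ... | no _  = trans (Σ-filter P? L f) (sym (trans (cong (_+ Σ L (λ y → ind (P? y) * f y)) (zeroˡ (f x))) (+-identityˡ _)))

    Σ-single : ∀ {L : List B} (f : B → A) {c} → Unique L → c ∈ L →
      (∀ {x} → x ∈ L → x ≢ c → f x ≡ 0#) → Σ L f ≡ f c
    Σ-single {L = x ∷ L} f (x∉ ∷ u) (here refl) e =
      trans (cong (f x +_) (Σ-0 L (λ y∈ → e (there y∈) (≢-sym (All.lookup x∉ y∈))))) (+-identityʳ (f x))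
    Σ-single {L = x ∷ L} f (x∉ ∷ u) (there c∈) e =
      trans (cong₂ _+_ (e (here refl) (All.lookup x∉ c∈)) (Σ-single f u c∈ (e ∘ there))) (+-identityˡ _)

  Σ-upTo-suc : ∀ k (f : ℕ → A) → Σ (upTo (suc k)) f ≡ f 0 + Σ (upTo k) (f ∘ suc)
  Σ-upTo-suc k f = trans (trans (cong (λ l → Σ l f) (upTo-suc k)) (Σ-∷ 0 _)) (cong (f 0 +_) (Σ-map (upTo k) suc f))

  Σ-upTo-extend : ∀ m n (f : ℕ → A) → (∀ i → m ≤ i → f i ≡ 0#) → Σ (upTo (m ℕ.+ n)) f ≡ Σ (upTo m) f
  Σ-upTo-extend zero n f e = trans (Σ-0 (upTo n) (λ {x} _ → e x ℕ.z≤n)) (sym Σ-[])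
  Σ-upTo-extend (suc m) n f e = begin
    Σ (upTo (suc (m ℕ.+ n))) f             ≡⟨ Σ-upTo-suc (m ℕ.+ n) f ⟩
    f 0 + Σ (upTo (m ℕ.+ n)) (f ∘ suc)     ≡⟨ cong (f 0 +_) (Σ-upTo-extend m n (f ∘ suc) (λ i le → e (suc i) (ℕ.s≤s le))) ⟩
    f 0 + Σ (upTo m) (f ∘ suc)             ≡⟨ sym (Σ-upTo-suc m f) ⟩
    Σ (upTo (suc m)) f                     ∎

  Σ-upTo-last : ∀ k (f : ℕ → A) → Σ (upTo (suc k)) f ≡ Σ (upTo k) f + f k
  Σ-upTo-last zero    f = trans (Σ-∷ 0 []) (+-comm (f 0) (Σ [] f))
  Σ-upTo-last (suc k) f = begin
    Σ (upTo (suc (suc k))) f                      ≡⟨ Σ-upTo-suc (suc k) f ⟩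
    f 0 + Σ (upTo (suc k)) (f ∘ suc)              ≡⟨ cong (f 0 +_) (Σ-upTo-last k (f ∘ suc)) ⟩
    f 0 + (Σ (upTo k) (f ∘ suc) + f (suc k))      ≡⟨ sym (+-assoc (f 0) _ _) ⟩
    (f 0 + Σ (upTo k) (f ∘ suc)) + f (suc k)      ≡⟨ cong (_+ f (suc k)) (sym (Σ-upTo-suc k f)) ⟩
    Σ (upTo (suc k)) f + f (suc k)                ∎

module ℤΣ = Sum ℤₚ.+-*-isCommutativeSemiring

range-0 : ∀ t → range 0 t ≡ upTo (suc t)
range-0 t = map-id (upTo (suc t))

module IntegerSums where
  open ℤΣ
  open import Data.Integer using (+_; _+_; _*_)

  Σ-const : ∀ {B : Set} (L : List B) c → Σ L (λ _ → c) ≡ + length L * c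
  Σ-const []      c = trans Σ-[] (sym (ℤₚ.*-zeroˡ c))
  Σ-const (x ∷ L) c = trans (Σ-∷ x L) (trans (cong (λ z → c + z) (Σ-const L c)) (lemma c (+ length L)))
    where
    lemma : ∀ c n → c + n * c ≡ (1ℤ + n) * c
    lemma = solve-∀

  length-filter : ∀ {B : Set} {P : Pred B _} (P? : Decidable P) L → + length (filter P? L) ≡ Σ L (λ x → ind (P? x))
  length-filter P? L = begin
    + length (filter P? L)        ≡⟨ sym (ℤₚ.*-identityʳ _) ⟩
    + length (filter P? L) * 1ℤ   ≡⟨ sym (Σ-const (filter P? L) 1ℤ) ⟩
    Σ (filter P? L) (λ _ → 1ℤ)    ≡⟨ Σ-filter P? L (λ _ → 1ℤ) ⟩
    Σ L (λ x → ind (P? x) * 1ℤ)   ≡⟨ Σ-cong L (λ x → ℤₚ.*-identityʳ (ind (P? x))) ⟩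
    Σ L (λ x → ind (P? x))        ∎
    where open ≡-Reasoning

-- Binomial sums, finite differences and Stirling numbers.

module BinomialSums where
  open ℤΣ
  open import Data.Integer using (+_; _+_; _*_; _-_; _^_)
  open ≡-Reasoning

  -- Pascal's rule applied under a sum. With `G` arbitrary it serves as the inductive step of
  -- `binomial-theorem`, `Δ-Σ`, `newton` and `multisetSum-insert`.
  pascal : ∀ k (G : ℕ → ℤ) →
    Σ (upTo (suc (suc k))) (λ l → + (suc k C l) * G l)
      ≡ Σ (upTo (suc k)) (λ l → + (k C l) * G l) + Σ (upTo (suc k)) (λ l → + (k C l) * G (suc l))
  pascal k G = begin
    Σ (upTo (suc (suc k))) (λ l → + (suc k C l) * G l)
      ≡⟨ Σ-upTo-suc (suc k) _ ⟩
    1ℤ * G 0 + Σ (upTo (suc k)) (λ l → + (suc k C suc l) * G (suc l))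
      ≡⟨ cong (λ z → 1ℤ * G 0 + z) (trans (Σ-cong (upTo (suc k)) split) (Σ-+ (upTo (suc k)) _ _)) ⟩
    1ℤ * G 0 + (A + B)
      ≡⟨ reorder (1ℤ * G 0) A B ⟩
    (1ℤ * G 0 + B) + A
      ≡⟨ cong (_+ A) (sym (Σ-upTo-suc (suc k) (λ l → + (k C l) * G l))) ⟩
    Σ (upTo (suc (suc k))) (λ l → + (k C l) * G l) + A
      ≡⟨ cong (_+ A) (Σ-upTo-last (suc k) _) ⟩
    (Σ (upTo (suc k)) (λ l → + (k C l) * G l) + + (k C suc k) * G (suc k)) + A
      -- The surplus top term l = k + 1 carries the coefficient C(k, k + 1) = 0.
      ≡⟨ cong (λ z → (Σ (upTo (suc k)) (λ l → + (k C l) * G l) + + z * G (suc k)) + A) (k>n⇒nCk≡0 (ℕₚ.n<1+n k)) ⟩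
    (Σ (upTo (suc k)) (λ l → + (k C l) * G l) + 0ℤ * G (suc k)) + A
      ≡⟨ cong (λ z → z + A) (trans (cong (λ z → Σ (upTo (suc k)) (λ l → + (k C l) * G l) + z) (ℤₚ.*-zeroˡ (G (suc k)))) (ℤₚ.+-identityʳ (Σ (upTo (suc k)) (λ l → + (k C l) * G l)))) ⟩
    Σ (upTo (suc k)) (λ l → + (k C l) * G l) + A ∎
    where
    A = Σ (upTo (suc k)) (λ l → + (k C l) * G (suc l))
    B = Σ (upTo (suc k)) (λ l → + (k C suc l) * G (suc l))
    split : ∀ l → + (suc k C suc l) * G (suc l) ≡ + (k C l) * G (suc l) + + (k C suc l) * G (suc l)
    split l = trans (cong (λ z → + z * G (suc l)) (sym (nCk+nC[k+1]≡[n+1]C[k+1] k l)))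
                    (trans (cong (_* G (suc l)) (ℤₚ.pos-+ (k C l) (k C suc l))) (ℤₚ.*-distribʳ-+ (G (suc l)) (+ (k C l)) (+ (k C suc l))))
    reorder : ∀ a b c → a + (b + c) ≡ (a + c) + b
    reorder = solve-∀

  binomial-theorem : ∀ h (x y : ℤ) →
    (x + y) ^ h ≡ Σ (upTo (suc h)) (λ l → + (h C l) * (x ^ (h ∸ l) * y ^ l))
  binomial-theorem zero    x y = sym (Σ-singleton 0)
  binomial-theorem (suc h) x y = begin
    (x + y) * (x + y) ^ h
      ≡⟨ ℤₚ.*-distribʳ-+ ((x + y) ^ h) x y ⟩
    x * (x + y) ^ h + y * (x + y) ^ h
      ≡⟨ cong₂ _+_ (expand x) (expand y) ⟩
    Σ L (λ l → x * (+ (h C l) * (x ^ (h ∸ l) * y ^ l))) + Σ L (λ l → y * (+ (h C l) * (x ^ (h ∸ l) * y ^ l)))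
      ≡⟨ cong₂ _+_ (Σ-cong∈ L (λ {l} l∈ → trans (left x (+ (h C l)) (x ^ (h ∸ l)) (y ^ l))
                      (cong (λ e → + (h C l) * (x ^ e * y ^ l)) (sym (ℕₚ.+-∸-assoc 1 (ℕₚ.≤-pred (∈-upTo⁻ l∈)))))))
                   (Σ-cong L (λ l → right y (+ (h C l)) (x ^ (h ∸ l)) (y ^ l))) ⟩
    Σ L (λ l → + (h C l) * (x ^ (suc h ∸ l) * y ^ l)) + Σ L (λ l → + (h C l) * (x ^ (h ∸ l) * y ^ suc l))
      ≡⟨ sym (pascal h (λ l → x ^ (suc h ∸ l) * y ^ l)) ⟩
    Σ (upTo (suc (suc h))) (λ l → + (suc h C l) * (x ^ (suc h ∸ l) * y ^ l)) ∎
    where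
    L = upTo (suc h)
    expand : ∀ z → z * (x + y) ^ h ≡ Σ L (λ l → z * (+ (h C l) * (x ^ (h ∸ l) * y ^ l)))
    expand z = trans (cong (z *_) (binomial-theorem h x y)) (sym (Σ-*ˡ L z _))
    left : ∀ x c p q → x * (c * (p * q)) ≡ c * ((x * p) * q)
    left = solve-∀
    right : ∀ y c p q → y * (c * (p * q)) ≡ c * (p * (y * q))
    right = solve-∀

  -- The t-th forward difference at 0. Shifting the function instead of the base point keeps every
  -- evaluation at 0.
  Δ : ℕ → (ℕ → ℤ) → ℤ
  Δ zero    G = G 0
  Δ (suc t) G = Δ t (G ∘ suc) - Δ t G

  Δ-cong : ∀ t {F G : ℕ → ℤ} → (∀ i → F i ≡ G i) → Δ t F ≡ Δ t G
  Δ-cong zero    e = e 0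
  Δ-cong (suc t) e = cong₂ _-_ (Δ-cong t (e ∘ suc)) (Δ-cong t e)

  Δ-+ : ∀ t (F G : ℕ → ℤ) → Δ t (λ i → F i + G i) ≡ Δ t F + Δ t G
  Δ-+ zero    F G = refl
  Δ-+ (suc t) F G = trans (cong₂ _-_ (Δ-+ t (F ∘ suc) (G ∘ suc)) (Δ-+ t F G))
                          (lemma (Δ t (F ∘ suc)) (Δ t (G ∘ suc)) (Δ t F) (Δ t G))
    where
    lemma : ∀ a b c d → (a + b) - (c + d) ≡ (a - c) + (b - d)
    lemma = solve-∀

  -- Identifies the alternating sum in the numerator of `S h t` as a finite difference.
  Δ-Σ : ∀ t (G : ℕ → ℤ) →
    Σ (upTo (suc t)) (λ j → + (t C j) * (sgn (t ∸ j) * G j)) ≡ Δ t G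
  Δ-Σ zero    G = trans (Σ-singleton 0) (lemma (G 0))
    where
    lemma : ∀ x → 1ℤ * (1ℤ * x) ≡ x
    lemma = solve-∀
  Δ-Σ (suc t) G = begin
    Σ (upTo (suc (suc t))) (λ j → + (suc t C j) * (sgn (suc t ∸ j) * G j))
      ≡⟨ pascal t (λ j → sgn (suc t ∸ j) * G j) ⟩
    Σ L (λ j → + (t C j) * (sgn (suc t ∸ j) * G j)) + Σ L (λ j → + (t C j) * (sgn (t ∸ j) * G (suc j)))
      ≡⟨ cong₂ _+_ (trans (Σ-cong∈ L (λ {j} → flip j)) (Σ-*ˡ L -1ℤ _)) (Δ-Σ t (G ∘ suc)) ⟩
    -1ℤ * Σ L (λ j → + (t C j) * (sgn (t ∸ j) * G j)) + Δ t (G ∘ suc)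
      ≡⟨ cong (λ z → -1ℤ * z + Δ t (G ∘ suc)) (Δ-Σ t G) ⟩
    -1ℤ * Δ t G + Δ t (G ∘ suc)
      ≡⟨ lemma (Δ t G) (Δ t (G ∘ suc)) ⟩
    Δ t (G ∘ suc) - Δ t G ∎
    where
    L = upTo (suc t)
    lemma : ∀ a b → -1ℤ * a + b ≡ b - a
    lemma = solve-∀
    assoc : ∀ c s g → c * ((-1ℤ * s) * g) ≡ -1ℤ * (c * (s * g))
    assoc = solve-∀
    flip : ∀ j → j ∈ L → + (t C j) * (sgn (suc t ∸ j) * G j) ≡ -1ℤ * (+ (t C j) * (sgn (t ∸ j) * G j))
    flip j j∈ = trans (cong (λ e → + (t C j) * (sgn e * G j)) (ℕₚ.+-∸-assoc 1 (ℕₚ.≤-pred (∈-upTo⁻ j∈))))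
                        (assoc (+ (t C j)) (sgn (t ∸ j)) (G j))

  -- Newton's forward difference formula. After `pascal`, the two sums combine termwise, because Δ t
  -- G plus the next difference is Δ t of the shifted function, and the induction continues with
  -- `G ∘ suc`.
  newton : ∀ w (G : ℕ → ℤ) → Σ (upTo (suc w)) (λ t → + (w C t) * Δ t G) ≡ G w
  newton zero    G = trans (Σ-singleton 0) (ℤₚ.*-identityˡ (G 0))
  newton (suc w) G = begin
    Σ (upTo (suc (suc w))) (λ t → + (suc w C t) * Δ t G)
      ≡⟨ pascal w (λ t → Δ t G) ⟩
    Σ L (λ t → + (w C t) * Δ t G) + Σ L (λ t → + (w C t) * (Δ t (G ∘ suc) - Δ t G))
      ≡⟨ sym (Σ-+ L _ _) ⟩
    Σ L (λ t → + (w C t) * Δ t G + + (w C t) * (Δ t (G ∘ suc) - Δ t G))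
      ≡⟨ Σ-cong L (λ t → lemma (+ (w C t)) (Δ t G) (Δ t (G ∘ suc))) ⟩
    Σ L (λ t → + (w C t) * Δ t (G ∘ suc))
      ≡⟨ newton w (G ∘ suc) ⟩
    G (suc w) ∎
    where
    L = upTo (suc w)
    lemma : ∀ c a b → c * a + c * (b - a) ≡ c * b
    lemma = solve-∀

  -- In the discrete product rule at 0 the term with the undifferenced factor j vanishes. What
  -- remains is t + 1 times the t-th difference of `f` at 1, written here through differences at 0;
  -- this is the recursion of the Stirling numbers.
  Δ-leibniz : ∀ t (f : ℕ → ℤ) →
    Δ (suc t) (λ j → + j * f j) ≡ + suc t * (Δ (suc t) f + Δ t f)
  Δ-leibniz zero    f = lemma (f 1) (f 0)
    where
    lemma : ∀ a b → 1ℤ * a - 0ℤ * b ≡ 1ℤ * ((a - b) + b)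
    lemma = solve-∀
  Δ-leibniz (suc t) f = begin
    Δ (suc t) (λ j → + suc j * f (suc j)) - Δ (suc t) (λ j → + j * f j)
      ≡⟨ cong (_- Δ (suc t) (λ j → + j * f j)) (Δ-cong (suc t) (λ j → shift (+ j) (f (suc j)))) ⟩
    Δ (suc t) (λ j → + j * f (suc j) + f (suc j)) - Δ (suc t) (λ j → + j * f j)
      ≡⟨ cong (_- Δ (suc t) (λ j → + j * f j)) (Δ-+ (suc t) (λ j → + j * f (suc j)) (f ∘ suc)) ⟩
    (Δ (suc t) (λ j → + j * f (suc j)) + Δ (suc t) (f ∘ suc)) - Δ (suc t) (λ j → + j * f j)
      ≡⟨ cong₂ (λ a b → (a + Δ (suc t) (f ∘ suc)) - b) (Δ-leibniz t (f ∘ suc)) (Δ-leibniz t f) ⟩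
    (+ suc t * (Δ (suc t) (f ∘ suc) + Δ t (f ∘ suc)) + Δ (suc t) (f ∘ suc)) - + suc t * (Δ (suc t) f + Δ t f)
      ≡⟨ lemma (+ suc t) (Δ (suc t) (f ∘ suc)) (Δ t (f ∘ suc)) (Δ t f) ⟩
    + suc (suc t) * (Δ (suc (suc t)) f + Δ (suc t) f) ∎
    where
    shift : ∀ j x → (1ℤ + j) * x ≡ j * x + x
    shift = solve-∀
    lemma : ∀ n a b c → (n * (a + b) + a) - n * ((b - c) + c) ≡ (1ℤ + n) * ((a - (b - c)) + (b - c))
    lemma = solve-∀

  -- The recursive form provides what the quotient defining `S` hides: a natural number whose
  -- product with t! is the numerator, and vanishing for t > h.
  stirling₂ : ℕ → ℕ → ℕ
  stirling₂ zero    zero    = 1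
  stirling₂ zero    (suc t) = 0
  stirling₂ (suc h) zero    = 0
  stirling₂ (suc h) (suc t) = suc t ℕ.* stirling₂ h (suc t) ℕ.+ stirling₂ h t

  power : ℕ → ℕ → ℤ
  power h j = + (j ℕ.^ h)

  Δ-const : ∀ t c → Δ (suc t) (λ _ → c) ≡ 0ℤ
  Δ-const zero    c = ℤₚ.+-inverseʳ c
  Δ-const (suc t) c = ℤₚ.+-inverseʳ (Δ (suc t) (λ _ → c))

  Δ-power : ∀ h t → Δ t (power h) ≡ + (t ! ℕ.* stirling₂ h t)
  Δ-power zero    zero    = refl
  Δ-power zero    (suc t) = trans (Δ-const t 1ℤ) (cong +_ (sym (ℕₚ.*-zeroʳ (suc t !))))
  Δ-power (suc h) zero    = refl
  Δ-power (suc h) (suc t) = begin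
    Δ (suc t) (power (suc h))
      ≡⟨ Δ-cong (suc t) (λ j → ℤₚ.pos-* j (j ℕ.^ h)) ⟩
    Δ (suc t) (λ j → + j * power h j)
      ≡⟨ Δ-leibniz t (power h) ⟩
    + suc t * (Δ (suc t) (power h) + Δ t (power h))
      ≡⟨ cong (+ suc t *_) (cong₂ _+_ (trans (Δ-power h (suc t)) (ℤₚ.pos-* (suc t !) b)) (trans (Δ-power h t) (ℤₚ.pos-* (t !) c))) ⟩
    + suc t * (+ (suc t !) * + b + + (t !) * + c)
      ≡⟨ cong (λ z → + suc t * (z * + b + + (t !) * + c)) (ℤₚ.pos-* (suc t) (t !)) ⟩
    + suc t * ((+ suc t * + (t !)) * + b + + (t !) * + c)
      ≡⟨ lemma (+ suc t) (+ (t !)) (+ b) (+ c) ⟩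
    (+ suc t * + (t !)) * (+ suc t * + b + + c)
      ≡⟨ sym (cong₂ _*_ (ℤₚ.pos-* (suc t) (t !)) (trans (ℤₚ.pos-+ (suc t ℕ.* b) c) (cong (_+ + c) (ℤₚ.pos-* (suc t) b)))) ⟩
    + (suc t !) * + stirling₂ (suc h) (suc t)
      ≡⟨ sym (ℤₚ.pos-* (suc t !) _) ⟩
    + (suc t ! ℕ.* stirling₂ (suc h) (suc t)) ∎
    where
    b = stirling₂ h (suc t)
    c = stirling₂ h t
    lemma : ∀ n f b c → n * ((n * f) * b + f * c) ≡ (n * f) * (n * b + c)
    lemma = solve-∀

  stirling₂-vanishes : ∀ h t → h < t → stirling₂ h t ≡ 0
  stirling₂-vanishes zero    (suc t) _         = refl
  stirling₂-vanishes (suc h) (suc t) (s≤s h<t) = trans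
    (cong₂ (λ a b → suc t ℕ.* a ℕ.+ b) (stirling₂-vanishes h (suc t) (ℕₚ.m<n⇒m<1+n h<t)) (stirling₂-vanishes h t h<t))
    (trans (ℕₚ.+-identityʳ _) (ℕₚ.*-zeroʳ (suc t)))

  Δ-power-vanishes : ∀ h t → h < t → Δ t (power h) ≡ 0ℤ
  Δ-power-vanishes h t h<t = trans (Δ-power h t)
    (cong +_ (trans (cong (t ! ℕ.*_) (stirling₂-vanishes h t h<t)) (ℕₚ.*-zeroʳ (t !))))

  -- The integer division in `S` is exact: by `Δ-power` its numerator is t! times `stirling₂ h t`.
  t!S≡Δ : ∀ h t → + (t !) * S h t ≡ Δ t (power h)
  t!S≡Δ h t = begin
    + (t !) * S h t
      ≡⟨ cong (λ z → + (t !) * (z ℤ./ℕ (t !)) {{t !≢0}}) numerator ⟩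
    + (t !) * + (((t ! ℕ.* stirling₂ h t) ℕ./ (t !)) {{t !≢0}})
      ≡⟨ cong (λ z → + (t !) * + (z ℕ./ (t !)) {{t !≢0}}) (ℕₚ.*-comm (t !) (stirling₂ h t)) ⟩
    + (t !) * + (((stirling₂ h t ℕ.* t !) ℕ./ (t !)) {{t !≢0}})
      ≡⟨ cong (λ z → + (t !) * + z) (m*n/n≡m (stirling₂ h t) (t !) {{t !≢0}}) ⟩
    + (t !) * + stirling₂ h t
      ≡⟨ sym (ℤₚ.pos-* (t !) _) ⟩
    + (t ! ℕ.* stirling₂ h t)
      ≡⟨ sym (Δ-power h t) ⟩
    Δ t (power h) ∎
    where
    assoc : ∀ s c p → s * c * p ≡ c * (s * p)
    assoc = solve-∀
    numerator : sumℤ (map (λ j → sgn (t ∸ j) * + (t C j) * + (j ℕ.^ h)) (range 0 t)) ≡ + (t ! ℕ.* stirling₂ h t)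
    numerator = begin
      sumℤ (map (λ j → sgn (t ∸ j) * + (t C j) * + (j ℕ.^ h)) (range 0 t))
        ≡⟨ sym (Σ-def (range 0 t) _) ⟩
      Σ (range 0 t) (λ j → sgn (t ∸ j) * + (t C j) * + (j ℕ.^ h))
        ≡⟨ cong (λ l → Σ l (λ j → sgn (t ∸ j) * + (t C j) * + (j ℕ.^ h))) (range-0 t) ⟩
      Σ (upTo (suc t)) (λ j → sgn (t ∸ j) * + (t C j) * + (j ℕ.^ h))
        ≡⟨ Σ-cong (upTo (suc t)) (λ j → assoc (sgn (t ∸ j)) (+ (t C j)) (power h j)) ⟩
      Σ (upTo (suc t)) (λ j → + (t C j) * (sgn (t ∸ j) * power h j))
        ≡⟨ Δ-Σ t (power h) ⟩
      Δ t (power h)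
        ≡⟨ Δ-power h t ⟩
      + (t ! ℕ.* stirling₂ h t) ∎

  -- Newton's sum naturally stops at w, but the moment formula needs a bound independent of w. Both
  -- sums are padded to a common length: terms beyond w vanish through C(w, t), terms beyond h
  -- because the higher differences of an h-th power are 0.
  power-newton : ∀ h w → power h w ≡ Σ (upTo (suc h)) (λ t → Δ t (power h) * + (w C t))
  power-newton h w = begin
    power h w
      ≡⟨ sym (newton w (power h)) ⟩
    Σ (upTo (suc w)) (λ t → + (w C t) * Δ t (power h))
      ≡⟨ sym (Σ-upTo-extend (suc w) (suc h) _ (λ t w<t → cong (λ z → + z * Δ t (power h)) (k>n⇒nCk≡0 w<t))) ⟩
    Σ (upTo (suc w ℕ.+ suc h)) (λ t → + (w C t) * Δ t (power h))
      ≡⟨ cong (λ n → Σ (upTo n) (λ t → + (w C t) * Δ t (power h))) (ℕₚ.+-comm (suc w) (suc h)) ⟩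
    Σ (upTo (suc h ℕ.+ suc w)) (λ t → + (w C t) * Δ t (power h))
      ≡⟨ Σ-upTo-extend (suc h) (suc w) _ (λ t h<t → trans (cong (+ (w C t) *_) (Δ-power-vanishes h t h<t)) (ℤₚ.*-zeroʳ (+ (w C t)))) ⟩
    Σ (upTo (suc h)) (λ t → + (w C t) * Δ t (power h))
      ≡⟨ Σ-cong (upTo (suc h)) (λ t → ℤₚ.*-comm (+ (w C t)) (Δ t (power h))) ⟩
    Σ (upTo (suc h)) (λ t → Δ t (power h) * + (w C t)) ∎

-- Finite fields: inverses, powers and Fermat's theorem.

module FieldTheory (F : FiniteField) where
  open FiniteField F
  open FF F
  open ≡-Reasoning

  commutativeRing : CommutativeRing 0ℓ 0ℓ
  commutativeRing = record { isCommutativeRing = isCommutativeRing }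

  open CommutativeRing commutativeRing public
    using (+-assoc; +-comm; +-identityˡ; +-identityʳ; *-assoc; *-comm; *-identityˡ; *-identityʳ
          ; zeroˡ; zeroʳ; distribˡ; distribʳ; -‿inverseˡ; -‿inverseʳ
          ; isCommutativeSemiring; commutativeSemiring; *-isCommutativeMonoid; ring)
  open RingProperties ring using (+-cancelˡ; +-cancelʳ)
  open SemiringSolver commutativeSemiring using (solve; _:+_; _:*_; _:=_; con)

  module FΣ = Sum isCommutativeSemiring

  *-nonzero : ∀ {x y} → x ≢ 0# → y ≢ 0# → x * y ≢ 0#
  *-nonzero {x} {y} x≢0 y≢0 xy≡0 = y≢0 (begin
    y                ≡⟨ sym (*-identityˡ y) ⟩
    1# * y           ≡⟨ cong (_* y) (sym (trans (*-comm _ x) (⁻¹-inverse x x≢0))) ⟩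
    (x ⁻¹ * x) * y   ≡⟨ *-assoc _ x y ⟩
    x ⁻¹ * (x * y)   ≡⟨ cong (x ⁻¹ *_) xy≡0 ⟩
    x ⁻¹ * 0#        ≡⟨ zeroʳ _ ⟩
    0#               ∎)

  ⁻¹-cancelˡ : ∀ {x} → x ≢ 0# → ∀ y → x ⁻¹ * (x * y) ≡ y
  ⁻¹-cancelˡ {x} x≢0 y = trans (sym (*-assoc _ x y))
    (trans (cong (_* y) (trans (*-comm _ x) (⁻¹-inverse x x≢0))) (*-identityˡ y))

  ⁻¹-cancelʳ : ∀ {x} → x ≢ 0# → ∀ y → x * (x ⁻¹ * y) ≡ y
  ⁻¹-cancelʳ {x} x≢0 y = trans (sym (*-assoc x _ y))
    (trans (cong (_* y) (⁻¹-inverse x x≢0)) (*-identityˡ y))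

  *-cancelˡ : ∀ {x y z} → x ≢ 0# → x * y ≡ x * z → y ≡ z
  *-cancelˡ {x} {y} {z} x≢0 e = trans (sym (⁻¹-cancelˡ x≢0 y)) (trans (cong (x ⁻¹ *_) e) (⁻¹-cancelˡ x≢0 z))

  ⁻¹-nonzero : ∀ {x} → x ≢ 0# → x ⁻¹ ≢ 0#
  ⁻¹-nonzero {x} x≢0 e = 0≢1 (trans (sym (trans (cong (x *_) e) (zeroʳ x))) (⁻¹-inverse x x≢0))

  ⁻¹-unique : ∀ {x y} → x ≢ 0# → x * y ≡ 1# → y ≡ x ⁻¹
  ⁻¹-unique {x} x≢0 e = *-cancelˡ x≢0 (trans e (sym (⁻¹-inverse x x≢0)))

  ⁻¹-distrib-* : ∀ {x y} → x ≢ 0# → y ≢ 0# → (x * y) ⁻¹ ≡ x ⁻¹ * y ⁻¹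
  ⁻¹-distrib-* {x} {y} x≢0 y≢0 = sym (⁻¹-unique (*-nonzero x≢0 y≢0) (begin
    (x * y) * (x ⁻¹ * y ⁻¹)
      ≡⟨ solve 4 (λ a b c d → (a :* b) :* (c :* d) := (a :* c) :* (b :* d)) refl x y (x ⁻¹) (y ⁻¹) ⟩
    (x * x ⁻¹) * (y * y ⁻¹) ≡⟨ cong₂ _*_ (⁻¹-inverse x x≢0) (⁻¹-inverse y y≢0) ⟩
    1# * 1#                 ≡⟨ *-identityˡ 1# ⟩
    1#                      ∎))

  square : Carrier → Carrier
  square x = x * x

  square-* : ∀ x y → square (x * y) ≡ square x * square y
  square-* = solve 2 (λ x y → (x :* y) :* (x :* y) := (x :* x) :* (y :* y)) refl

  pow-+ : ∀ x m n → pow x (m ℕ.+ n) ≡ pow x m * pow x n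
  pow-+ x zero    n = sym (*-identityˡ _)
  pow-+ x (suc m) n = trans (cong (x *_) (pow-+ x m n)) (sym (*-assoc x _ _))

  pow-nonzero : ∀ {x} → x ≢ 0# → ∀ n → pow x n ≢ 0#
  pow-nonzero x≢0 zero    = 0≢1 ∘ sym
  pow-nonzero x≢0 (suc n) = *-nonzero x≢0 (pow-nonzero x≢0 n)

  nmul-+ : ∀ m n b → nmul (m ℕ.+ n) b ≡ nmul m b + nmul n b
  nmul-+ zero    n b = sym (+-identityˡ _)
  nmul-+ (suc m) n b = trans (cong (b +_) (nmul-+ m n b)) (sym (+-assoc b _ _))

  frob : ℕ → Carrier → Carrier
  frob i x = pow x (2 ℕ.^ i)

  frob-suc : ∀ i x → frob (suc i) x ≡ square (frob i x)
  frob-suc i x = trans (cong (λ n → pow x (2 ℕ.^ i ℕ.+ n)) (ℕₚ.+-identityʳ (2 ℕ.^ i))) (pow-+ x (2 ℕ.^ i) (2 ℕ.^ i))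

  frob-square : ∀ i x → frob i (square x) ≡ square (frob i x)
  frob-square zero    x = solve 1 (λ x → (x :* x) :* con 1 := (x :* con 1) :* (x :* con 1)) refl x
  frob-square (suc i) x = begin
    frob (suc i) (square x)     ≡⟨ frob-suc i (square x) ⟩
    square (frob i (square x))  ≡⟨ cong square (trans (frob-square i x) (sym (frob-suc i x))) ⟩
    square (frob (suc i) x)     ∎

  elements-↭ : (σ τ : Carrier → Carrier) → (∀ x → τ (σ x) ≡ x) → (∀ x → σ (τ x) ≡ x) → map σ elements ↭ elements
  elements-↭ σ τ τσ στ = unique-↭
    (Unique.map⁺ (λ {x} {y} e → trans (sym (τσ x)) (trans (cong τ e) (τσ y))) elements-unique) elements-unique
    (λ _ → elements-complete _)
    (λ {x} _ → subst (_∈ map σ elements) (στ x) (∈-map⁺ σ (elements-complete (τ x))))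

  nonzero∈ : ∀ {x} → x ≢ 0# → x ∈ nonzeros
  nonzero∈ {x} x≢0 = ∈-filter⁺ (λ x → ¬? (x ≟ 0#)) (elements-complete x) x≢0

  ∈nonzeros : ∀ {x} → x ∈ nonzeros → x ≢ 0#
  ∈nonzeros x∈ = proj₂ (∈-filter⁻ (λ x → ¬? (x ≟ 0#)) {xs = elements} x∈)

  nonzeros-unique : Unique nonzeros
  nonzeros-unique = Unique.filter⁺ (λ x → ¬? (x ≟ 0#)) elements-unique

  nonzeros-↭ : (σ τ : Carrier → Carrier) → (∀ x → τ (σ x) ≡ x) → (∀ x → σ (τ x) ≡ x) →
    (∀ {x} → x ≢ 0# → σ x ≢ 0#) → (∀ {x} → x ≢ 0# → τ x ≢ 0#) → map σ nonzeros ↭ nonzeros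
  nonzeros-↭ σ τ τσ στ σ≢0 τ≢0 = unique-↭
    (Unique.map⁺ (λ {x} {y} e → trans (sym (τσ x)) (trans (cong τ e) (τσ y))) nonzeros-unique) nonzeros-unique
    to
    (λ {x} x∈ → subst (_∈ map σ nonzeros) (στ x) (∈-map⁺ σ (nonzero∈ (τ≢0 (∈nonzeros x∈)))))
    where
    to : ∀ {x} → x ∈ map σ nonzeros → x ∈ nonzeros
    to x∈ with ∈-map⁻ σ x∈
    ... | y , y∈ , refl = nonzero∈ (σ≢0 (∈nonzeros y∈))

  scale-↭ : ∀ {c} → c ≢ 0# → map (c *_) nonzeros ↭ nonzeros
  scale-↭ {c} c≢0 = nonzeros-↭ (c *_) (c ⁻¹ *_) (⁻¹-cancelˡ c≢0) (⁻¹-cancelʳ c≢0) (*-nonzero c≢0) (*-nonzero (⁻¹-nonzero c≢0))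

  elements-split : elements ↭ 0# ∷ nonzeros
  elements-split = unique-↭ elements-unique
    (All.tabulate (λ x∈ e → ∈nonzeros x∈ (sym e)) ∷ nonzeros-unique)
    split (λ _ → elements-complete _)
    where
    split : ∀ {x} → x ∈ elements → x ∈ 0# ∷ nonzeros
    split {x} _ with x ≟ 0#
    ... | yes refl = here refl
    ... | no x≢0   = there (nonzero∈ x≢0)

  prodF-↭ : ∀ {xs ys} → xs ↭ ys → prodF xs ≡ prodF ys
  prodF-↭ p = foldr-commMonoid (setoid Carrier) *-isCommutativeMonoid (↭⇒↭ₛ p)

  prodF-scale : ∀ c xs → prodF (map (c *_) xs) ≡ pow c (length xs) * prodF xs
  prodF-scale c []       = sym (*-identityˡ 1#)
  prodF-scale c (x ∷ xs) = trans (cong ((c * x) *_) (prodF-scale c xs))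
    (solve 4 (λ c x p q → (c :* x) :* (p :* q) := (c :* p) :* (x :* q)) refl c x (pow c (length xs)) (prodF xs))

  prodF-nonzero : ∀ xs → (∀ {x} → x ∈ xs → x ≢ 0#) → prodF xs ≢ 0#
  prodF-nonzero []       n = 0≢1 ∘ sym
  prodF-nonzero (x ∷ xs) n = *-nonzero (n (here refl)) (prodF-nonzero xs (n ∘ there))

  -- Multiplication by x permutes the nonzero elements, so their product is unchanged although it
  -- picks up one factor x per element; the nonzero product then cancels.
  fermat : ∀ {x} → x ≢ 0# → pow x (length nonzeros) ≡ 1#
  fermat {x} x≢0 = *-cancelˡ (prodF-nonzero nonzeros ∈nonzeros) (begin
    prodF nonzeros * pow x (length nonzeros)   ≡⟨ *-comm _ _ ⟩
    pow x (length nonzeros) * prodF nonzeros   ≡⟨ sym (prodF-scale x nonzeros) ⟩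
    prodF (map (x *_) nonzeros)                ≡⟨ prodF-↭ (scale-↭ x≢0) ⟩
    prodF nonzeros                             ≡⟨ sym (*-identityʳ _) ⟩
    prodF nonzeros * 1#                        ∎)

  Σ-constF : ∀ {B : Set} (L : List B) → FΣ.Σ L (λ _ → 1#) ≡ nmul (length L) 1#
  Σ-constF []      = FΣ.Σ-[]
  Σ-constF (x ∷ L) = trans (FΣ.Σ-∷ x L) (cong (1# +_) (Σ-constF L))

  -- Lagrange for the additive group: translation by 1 permutes the field.
  card×1≡0 : nmul (length elements) 1# ≡ 0#
  card×1≡0 = +-cancelˡ (FΣ.Σ elements id) _ _ (begin
    FΣ.Σ elements id + nmul (length elements) 1#        ≡⟨ cong (FΣ.Σ elements id +_) (sym (Σ-constF elements)) ⟩
    FΣ.Σ elements id + FΣ.Σ elements (λ _ → 1#)         ≡⟨ sym (FΣ.Σ-+ elements id (λ _ → 1#)) ⟩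
    FΣ.Σ elements (λ x → x + 1#)                        ≡⟨ sym (FΣ.Σ-map elements (_+ 1#) id) ⟩
    FΣ.Σ (map (_+ 1#) elements) id                      ≡⟨ FΣ.Σ-↭ id (elements-↭ (_+ 1#) (_+ (- 1#)) (cancel (-‿inverseʳ 1#)) (cancel (-‿inverseˡ 1#))) ⟩
    FΣ.Σ elements id                                    ≡⟨ sym (+-identityʳ _) ⟩
    FΣ.Σ elements id + 0#                               ∎)
    where
    cancel : ∀ {a b} → a + b ≡ 0# → ∀ x → (x + a) + b ≡ x
    cancel {a} {b} e x = trans (+-assoc x a b) (trans (cong (x +_) e) (+-identityʳ x))

  nmul-2^ : ∀ k → nmul (2 ℕ.^ k) 1# ≡ pow (1# + 1#) k
  nmul-2^ zero    = +-identityʳ 1#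
  nmul-2^ (suc k) = begin
    nmul (2 ℕ.^ k ℕ.+ (2 ℕ.^ k ℕ.+ 0)) 1#       ≡⟨ cong (λ n → nmul (2 ℕ.^ k ℕ.+ n) 1#) (ℕₚ.+-identityʳ (2 ℕ.^ k)) ⟩
    nmul (2 ℕ.^ k ℕ.+ 2 ℕ.^ k) 1#               ≡⟨ nmul-+ (2 ℕ.^ k) (2 ℕ.^ k) 1# ⟩
    nmul (2 ℕ.^ k) 1# + nmul (2 ℕ.^ k) 1#       ≡⟨ cong₂ _+_ (nmul-2^ k) (nmul-2^ k) ⟩
    pow (1# + 1#) k + pow (1# + 1#) k           ≡⟨ solve 1 (λ p → p :+ p := (con 1 :+ con 1) :* p) refl (pow (1# + 1#) k) ⟩
    (1# + 1#) * pow (1# + 1#) k                 ∎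

  -- Characteristic two, the Frobenius map and the trace.

  module Binary (r : ℕ) (card : length elements ≡ 2 ℕ.^ r) where

    -- The cardinality 2^r annihilates 1, so (1 + 1)^r = 0, and a field has no nonzero nilpotents.
    1+1≡0 : 1# + 1# ≡ 0#
    1+1≡0 with (1# + 1#) ≟ 0#
    ... | yes e = e
    ... | no ne = ⊥-elim (pow-nonzero ne r (trans (sym (nmul-2^ r)) (trans (cong (λ n → nmul n 1#) (sym card)) card×1≡0)))

    x+x≡0 : ∀ x → x + x ≡ 0#
    x+x≡0 x = trans (solve 1 (λ x → x :+ x := (con 1 :+ con 1) :* x) refl x) (trans (cong (_* x) 1+1≡0) (zeroˡ x))

    x+y≡0⇒x≡y : ∀ {x y} → x + y ≡ 0# → x ≡ y
    x+y≡0⇒x≡y {x} {y} e = +-cancelʳ y x y (trans e (sym (x+x≡0 y)))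

    +-selfcancel : ∀ x y → (y + x) + x ≡ y
    +-selfcancel x y = trans (+-assoc y x x) (trans (cong (y +_) (x+x≡0 x)) (+-identityʳ y))

    translate-↭ : ∀ c → map (_+ c) elements ↭ elements
    translate-↭ c = elements-↭ (_+ c) (_+ c) (+-selfcancel c) (+-selfcancel c)

    square-+ : ∀ x y → square (x + y) ≡ square x + square y
    square-+ x y = trans
      (solve 2 (λ x y → (x :+ y) :* (x :+ y) := (x :* x :+ y :* y) :+ (x :* y :+ x :* y)) refl x y)
      (trans (cong ((square x + square y) +_) (x+x≡0 (x * y))) (+-identityʳ _))

    square-Σ : ∀ {B : Set} (L : List B) f → FΣ.Σ L (square ∘ f) ≡ square (FΣ.Σ L f)
    square-Σ []      f = trans FΣ.Σ-[] (trans (sym (zeroˡ 0#)) (cong square (sym FΣ.Σ-[])))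
    square-Σ (x ∷ L) f = begin
      FΣ.Σ (x ∷ L) (square ∘ f)              ≡⟨ FΣ.Σ-∷ x L ⟩
      square (f x) + FΣ.Σ L (square ∘ f)     ≡⟨ cong (square (f x) +_) (square-Σ L f) ⟩
      square (f x) + square (FΣ.Σ L f)       ≡⟨ sym (square-+ _ _) ⟩
      square (f x + FΣ.Σ L f)                ≡⟨ cong square (sym (FΣ.Σ-∷ x L)) ⟩
      square (FΣ.Σ (x ∷ L) f)                ∎

    frob-+ : ∀ i x y → frob i (x + y) ≡ frob i x + frob i y
    frob-+ zero    x y = distribʳ 1# x y
    frob-+ (suc i) x y = begin
      frob (suc i) (x + y)                  ≡⟨ frob-suc i (x + y) ⟩
      square (frob i (x + y))               ≡⟨ cong square (frob-+ i x y) ⟩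
      square (frob i x + frob i y)          ≡⟨ square-+ _ _ ⟩
      square (frob i x) + square (frob i y) ≡⟨ sym (cong₂ _+_ (frob-suc i x) (frob-suc i y)) ⟩
      frob (suc i) x + frob (suc i) y       ∎

    card-nonzeros : suc (length nonzeros) ≡ 2 ℕ.^ r
    card-nonzeros = trans (sym (↭-length elements-split)) card

    frob-r : ∀ x → frob r x ≡ x
    frob-r x = trans (cong (pow x) (sym card-nonzeros)) last
      where
      last : x * pow x (length nonzeros) ≡ x
      last with x ≟ 0#
      ... | yes refl = zeroˡ _
      ... | no x≢0   = trans (cong (x *_) (fermat x≢0)) (*-identityʳ x)

    tr-Σ : ∀ x → tr r x ≡ FΣ.Σ (upTo r) (λ i → frob i x)
    tr-Σ x = sym (FΣ.Σ-def (upTo r) _)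

    tr-+ : ∀ x y → tr r (x + y) ≡ tr r x + tr r y
    tr-+ x y = begin
      tr r (x + y)                                                     ≡⟨ tr-Σ (x + y) ⟩
      FΣ.Σ (upTo r) (λ i → frob i (x + y))                             ≡⟨ FΣ.Σ-cong (upTo r) (λ i → frob-+ i x y) ⟩
      FΣ.Σ (upTo r) (λ i → frob i x + frob i y)                        ≡⟨ FΣ.Σ-+ (upTo r) _ _ ⟩
      FΣ.Σ (upTo r) (λ i → frob i x) + FΣ.Σ (upTo r) (λ i → frob i y)  ≡⟨ sym (cong₂ _+_ (tr-Σ x) (tr-Σ y)) ⟩
      tr r x + tr r y                                                  ∎

    tr-square : ∀ x → tr r (square x) ≡ square (tr r x)
    tr-square x = begin
      tr r (square x)                           ≡⟨ tr-Σ (square x) ⟩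
      FΣ.Σ (upTo r) (λ i → frob i (square x))   ≡⟨ FΣ.Σ-cong (upTo r) (λ i → frob-square i x) ⟩
      FΣ.Σ (upTo r) (λ i → square (frob i x))   ≡⟨ square-Σ (upTo r) (λ i → frob i x) ⟩
      square (FΣ.Σ (upTo r) (λ i → frob i x))   ≡⟨ cong square (sym (tr-Σ x)) ⟩
      square (tr r x)                           ∎

    -- Squaring shifts the conjugates in the trace by one place, and `frob-r` closes the cycle.
    -- After adding x, both sides are the sum of the r + 1 conjugates with exponents 2^0, ..., 2^r.
    tr-idempotent : ∀ x → square (tr r x) ≡ tr r x
    tr-idempotent x = +-cancelˡ x _ _ (begin
      x + square (tr r x)
        ≡⟨ cong₂ _+_ (sym (*-identityʳ x)) (trans (cong square (tr-Σ x)) (sym (square-Σ (upTo r) (λ i → frob i x)))) ⟩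
      frob 0 x + FΣ.Σ (upTo r) (λ i → square (frob i x))
        ≡⟨ cong (frob 0 x +_) (FΣ.Σ-cong (upTo r) (λ i → sym (frob-suc i x))) ⟩
      frob 0 x + FΣ.Σ (upTo r) (λ i → frob (suc i) x)
        ≡⟨ sym (FΣ.Σ-upTo-suc r (λ i → frob i x)) ⟩
      FΣ.Σ (upTo (suc r)) (λ i → frob i x)
        ≡⟨ FΣ.Σ-upTo-last r (λ i → frob i x) ⟩
      FΣ.Σ (upTo r) (λ i → frob i x) + frob r x
        ≡⟨ cong₂ _+_ (sym (tr-Σ x)) (frob-r x) ⟩
      tr r x + x
        ≡⟨ +-comm _ x ⟩
      x + tr r x ∎)

    tr≡0⊎1 : ∀ x → tr r x ≡ 0# ⊎ tr r x ≡ 1#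
    tr≡0⊎1 x with tr r x ≟ 0#
    ... | yes e = inj₁ e
    ... | no ne = inj₂ (*-cancelˡ ne (trans (tr-idempotent x) (sym (*-identityʳ _))))

    -- Lead d c f: f is a polynomial function of degree at most d with c as its
    -- coefficient of degree d; each root can be divided out (x + a is x - a here).
    Lead : ℕ → Carrier → (Carrier → Carrier) → Set
    Lead zero    c f = ∀ x → f x ≡ c
    Lead (suc d) c f = ∀ a → Σ[ g ∈ (Carrier → Carrier) ] (Lead d c g × (∀ x → f x ≡ f a + (x + a) * g x))

    lead-cong : ∀ d {c c′ f f′} → c ≡ c′ → (∀ x → f x ≡ f′ x) → Lead d c f → Lead d c′ f′
    lead-cong zero    refl e l x = trans (sym (e x)) (l x)
    lead-cong (suc d) refl e l a with l a
    ... | g , lg , eq = g , lg , λ x → trans (sym (e x)) (trans (eq x) (cong (_+ ((x + a) * g x)) (e a)))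

    lead-+ : ∀ d {c c′ f f′} → Lead d c f → Lead d c′ f′ → Lead d (c + c′) (λ x → f x + f′ x)
    lead-+ zero    l l′ x = cong₂ _+_ (l x) (l′ x)
    lead-+ (suc d) {f = f} {f′} l l′ a with l a | l′ a
    ... | g , lg , e | g′ , lg′ , e′ = (λ x → g x + g′ x) , lead-+ d lg lg′ , λ x → trans (cong₂ _+_ (e x) (e′ x))
      (solve 5 (λ u v w p q → (u :+ w :* p) :+ (v :+ w :* q) := (u :+ v) :+ w :* (p :+ q)) refl (f a) (f′ a) (x + a) (g x) (g′ x))

    lead-scale : ∀ d k {c f} → Lead d c f → Lead d (k * c) (λ x → k * f x)
    lead-scale zero    k l x = cong (k *_) (l x)
    lead-scale (suc d) k {f = f} l a with l a
    ... | g , lg , e = (λ x → k * g x) , lead-scale d k lg , λ x → trans (cong (k *_) (e x))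
      (solve 4 (λ k u w p → k :* (u :+ w :* p) := k :* u :+ w :* (k :* p)) refl k (f a) (x + a) (g x))

    lead-raise : ∀ d {c f} → Lead d c f → Lead (suc d) 0# f
    lead-raise zero    {f = f} l a = (λ _ → 0#) , (λ _ → refl) , λ x →
      trans (trans (l x) (sym (l a))) (sym (trans (cong (f a +_) (zeroʳ _)) (+-identityʳ _)))
    lead-raise (suc d) l a with l a
    ... | g , lg , e = g , lead-raise d lg , e

    lead-raise-+ : ∀ k d {c f} → Lead d c f → Lead (suc (k ℕ.+ d)) 0# f
    lead-raise-+ zero    d l = lead-raise d l
    lead-raise-+ (suc k) d l = lead-raise (suc (k ℕ.+ d)) (lead-raise-+ k d l)

    lead-x* : ∀ d {c f} → Lead d c f → Lead (suc d) c (λ x → x * f x)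
    lead-x* zero {c} {f} l a = (λ _ → c) , (λ _ → refl) , λ x → begin
      x * f x                   ≡⟨ cong (x *_) (l x) ⟩
      x * c                     ≡⟨ sym (+-selfcancel (a * c) (x * c)) ⟩
      (x * c + a * c) + a * c   ≡⟨ solve 3 (λ x a c → (x :* c :+ a :* c) :+ a :* c := a :* c :+ (x :+ a) :* c) refl x a c ⟩
      a * c + (x + a) * c       ≡⟨ cong (λ z → a * z + (x + a) * c) (sym (l a)) ⟩
      a * f a + (x + a) * c     ∎
    lead-x* (suc d) {c} {f} l a with l a
    -- The witness comes from x f(x) + a f(a) = (x + a) f(x) + a (f(x) + f(a)), valid in
    -- characteristic 2, where the last bracket is (x + a) g(x). The summand a g has lower degree
    -- and leaves the leading coefficient alone.
    ... | g , lg , e = (λ x → f x + a * g x)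
      , lead-cong (suc d) (+-identityʳ c) (λ _ → refl) (lead-+ (suc d) l (lead-raise d (lead-scale d a lg)))
      , λ x → begin
        x * f x
          ≡⟨ sym (+-selfcancel (a * f x) (x * f x)) ⟩
        (x * f x + a * f x) + a * f x
          ≡⟨ cong (λ z → (x * f x + a * f x) + a * z) (e x) ⟩
        (x * f x + a * f x) + a * (f a + (x + a) * g x)
          ≡⟨ solve 5 (λ x a u v w → (x :* u :+ a :* u) :+ a :* (v :+ (x :+ a) :* w) := a :* v :+ (x :+ a) :* (u :+ a :* w)) refl x a (f x) (f a) (g x) ⟩
        a * f a + (x + a) * (f x + a * g x) ∎

    lead-pow : ∀ k → Lead k 1# (λ x → pow x k)
    lead-pow zero    x = refl
    lead-pow (suc k)   = lead-x* k (lead-pow k)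

    -- The last conjugate dominates: the shorter trace has degree 2^k, and regarded as a polynomial
    -- of degree 2^(k+1) it has leading coefficient 0.
    lead-trace : ∀ k → Lead (2 ℕ.^ k) 1# (λ x → FΣ.Σ (upTo (suc k)) (λ i → frob i x))
    lead-trace zero    = lead-cong 1 refl (λ x → sym (FΣ.Σ-singleton 0)) (lead-pow 1)
    lead-trace (suc k) = lead-cong (2 ℕ.^ suc k) (+-identityˡ 1#) (λ x → sym (FΣ.Σ-upTo-last (suc k) (λ i → frob i x)))
      (lead-+ (2 ℕ.^ suc k) (subst (λ d → Lead d 0# (λ x → FΣ.Σ (upTo (suc k)) (λ i → frob i x))) degree
                              (lead-raise-+ (ℕ.pred (2 ℕ.^ k)) (2 ℕ.^ k) (lead-trace k)))
                            (lead-pow (2 ℕ.^ suc k)))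
      where
      degree : suc (ℕ.pred (2 ℕ.^ k) ℕ.+ 2 ℕ.^ k) ≡ 2 ℕ.^ suc k
      degree = cong₂ ℕ._+_ (ℕₚ.suc-pred (2 ℕ.^ k) {{ℕₚ.m^n≢0 2 k}}) (sym (ℕₚ.+-identityʳ (2 ℕ.^ k)))

    -- Dividing out the first root a leaves a quotient with the same leading coefficient that
    -- vanishes at all other listed roots, because x + a is nonzero there by uniqueness.
    root-bound : ∀ d {c f} → Lead d c f → c ≢ 0# → ∀ {xs} → Unique xs → (∀ {x} → x ∈ xs → f x ≡ 0#) → length xs ≤ d
    root-bound d       l c≢0 {[]}     u        z = z≤n
    root-bound zero    l c≢0 {x ∷ xs} u        z = ⊥-elim (c≢0 (trans (sym (l x)) (z (here refl))))
    root-bound (suc d) {f = f} l c≢0 {a ∷ xs} (a∉ ∷ u) z with l a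
    ... | g , lg , e = s≤s (root-bound d lg c≢0 u root)
      where
      root : ∀ {x} → x ∈ xs → g x ≡ 0#
      root {x} x∈ with g x ≟ 0#
      ... | yes gx≡0 = gx≡0
      ... | no gx≢0  = ⊥-elim (*-nonzero (λ x+a≡0 → All.lookup a∉ x∈ (sym (x+y≡0⇒x≡y x+a≡0))) gx≢0 (begin
        (x + a) * g x         ≡⟨ sym (+-identityˡ _) ⟩
        0# + (x + a) * g x    ≡⟨ cong (_+ ((x + a) * g x)) (sym (z (here refl))) ⟩
        f a + (x + a) * g x   ≡⟨ sym (e x) ⟩
        f x                   ≡⟨ z (there x∈) ⟩
        0#                    ∎))

    -- Otherwise a polynomial of degree 2^(r-1) with leading coefficient 1 would have 2^r distinct
    -- roots.
    tr-nontrivial : ∀ k → r ≡ suc k → ∃ λ z → tr r z ≢ 0#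
    tr-nontrivial k r≡1+k with all? (λ x → tr r x ≟ 0#) elements
    ... | no ¬all = let z , _ , nz = find (¬All⇒Any¬ (λ x → tr r x ≟ 0#) elements ¬all) in z , nz
    ... | yes all = ⊥-elim (ℕₚ.<⇒≱ (ℕₚ.^-monoʳ-< 2 (s≤s (s≤s z≤n)) (ℕₚ.n<1+n k))
      (subst (_≤ 2 ℕ.^ k) (trans card (cong (2 ℕ.^_) r≡1+k))
        (root-bound (2 ℕ.^ k) (lead-trace k) (0≢1 ∘ sym) elements-unique root)))
      where
      root : ∀ {x} → x ∈ elements → FΣ.Σ (upTo (suc k)) (λ i → frob i x) ≡ 0#
      root {x} x∈ = trans (cong (λ n → FΣ.Σ (upTo n) (λ i → frob i x)) (sym r≡1+k))
                          (trans (sym (tr-Σ x)) (All.lookup all x∈))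

sgn-square : ∀ k → sgn k ℤ.* sgn k ≡ 1ℤ
sgn-square zero    = refl
sgn-square (suc k) = trans (lemma (sgn k)) (sgn-square k)
  where
  lemma : ∀ x → (-1ℤ ℤ.* x) ℤ.* (-1ℤ ℤ.* x) ≡ x ℤ.* x
  lemma = solve-∀

sgn-+ : ∀ j k → sgn (j ℕ.+ k) ≡ sgn j ℤ.* sgn k
sgn-+ = ℤₚ.^-distribˡ-+-* -1ℤ

-- For s ≥ 1 the number 2^s is even, hence m is odd; this fixes the sign of the constant term of δ.
sgn-2^∸1 : ∀ {m} s → 1 ≤ s → suc m ≡ 2 ℕ.^ s → sgn m ≡ -1ℤ
sgn-2^∸1 {m} (suc s) _ e = trans (lemma (sgn m)) (cong (-1ℤ ℤ.*_) even)
  where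
  lemma : ∀ x → x ≡ -1ℤ ℤ.* (-1ℤ ℤ.* x)
  lemma = solve-∀
  even : sgn (suc m) ≡ 1ℤ
  even = trans (cong sgn (trans e (cong (2 ℕ.^ s ℕ.+_) (ℕₚ.+-identityʳ (2 ℕ.^ s)))))
               (trans (sgn-+ (2 ℕ.^ s) (2 ℕ.^ s)) (sgn-square (2 ℕ.^ s)))

-- Additive characters, Kloosterman sums and the values of δ.

module CharacterSums (F : FiniteField) (r k : ℕ) (r≡1+k : r ≡ suc k)
                     (card : length (FiniteField.elements F) ≡ 2 ℕ.^ r) where
  open FiniteField F
  open FF F
  open FieldTheory F
  open Binary r card
  open ℤΣ
  open IntegerSums
  open import Data.Integer using (+_)
  open ≡-Reasoning

  q : ℕ
  q = 2 ℕ.^ r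

  signOf : Carrier → ℤ
  signOf t = if does (t ≟ 0#) then 1ℤ else -1ℤ

  signOf-zero : ∀ {t} → t ≡ 0# → signOf t ≡ 1ℤ
  signOf-zero {t} e with t ≟ 0#
  ... | yes _ = refl
  ... | no ne = ⊥-elim (ne e)

  signOf-nonzero : ∀ {t} → t ≢ 0# → signOf t ≡ -1ℤ
  signOf-nonzero {t} ne with t ≟ 0#
  ... | yes e = ⊥-elim (ne e)
  ... | no _  = refl

  signOf-one : ∀ {t} → t ≡ 1# → signOf t ≡ -1ℤ
  signOf-one e = signOf-nonzero (λ t≡0 → 0≢1 (trans (sym t≡0) e))

  opaque
    ψ : Carrier → ℤ
    ψ = χ r

    ψ-def : ∀ x → χ r x ≡ ψ x
    ψ-def x = refl

    ψ-+ : ∀ x y → ψ (x + y) ≡ ψ x ℤ.* ψ y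
    ψ-+ x y with tr≡0⊎1 x | tr≡0⊎1 y
    ... | inj₁ a | inj₁ b = trans (signOf-zero (trans (tr-+ x y) (trans (cong₂ _+_ a b) (+-identityˡ 0#))))
                                  (sym (cong₂ ℤ._*_ (signOf-zero a) (signOf-zero b)))
    ... | inj₁ a | inj₂ b = trans (signOf-one (trans (tr-+ x y) (trans (cong₂ _+_ a b) (+-identityˡ 1#))))
                                  (sym (cong₂ ℤ._*_ (signOf-zero a) (signOf-one b)))
    ... | inj₂ a | inj₁ b = trans (signOf-one (trans (tr-+ x y) (trans (cong₂ _+_ a b) (+-identityʳ 1#))))
                                  (sym (cong₂ ℤ._*_ (signOf-one a) (signOf-zero b)))
    ... | inj₂ a | inj₂ b = trans (signOf-zero (trans (tr-+ x y) (trans (cong₂ _+_ a b) 1+1≡0)))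
                                  (sym (cong₂ ℤ._*_ (signOf-one a) (signOf-one b)))

    ψ-square : ∀ x → ψ (square x) ≡ ψ x
    ψ-square x = cong signOf (trans (tr-square x) (tr-idempotent x))

    ψ-±1 : ∀ x → ψ x ≡ 1ℤ ⊎ ψ x ≡ -1ℤ
    ψ-±1 x with tr≡0⊎1 x
    ... | inj₁ a = inj₁ (signOf-zero a)
    ... | inj₂ a = inj₂ (signOf-one a)

    ψ-nontrivial : ∃ λ z → ψ z ≡ -1ℤ
    ψ-nontrivial = let z , nz = tr-nontrivial k r≡1+k in z , signOf-nonzero nz

  ψ-0 : ψ 0# ≡ 1ℤ
  ψ-0 with ψ-±1 0#
  ... | inj₁ e = e
  ... | inj₂ e = trans (cong ψ (sym (+-identityˡ 0#))) (trans (ψ-+ 0# 0#) (cong₂ ℤ._*_ e e))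

  -- Translating by an element z with ψ z = -1 permutes the field and negates the sum, so twice the
  -- sum is 0.
  Σψ≡0 : Σ elements ψ ≡ 0ℤ
  Σψ≡0 with ψ-nontrivial
  ... | z , ψz≡-1 = double (begin
    Σ elements ψ                          ≡⟨ sym (Σ-↭ ψ (translate-↭ z)) ⟩
    Σ (map (_+ z) elements) ψ             ≡⟨ Σ-map elements (_+ z) ψ ⟩
    Σ elements (λ x → ψ (x + z))          ≡⟨ Σ-cong elements (λ x → trans (ψ-+ x z) (cong (ψ x ℤ.*_) ψz≡-1)) ⟩
    Σ elements (λ x → ψ x ℤ.* -1ℤ)        ≡⟨ Σ-*ʳ elements -1ℤ ψ ⟩
    Σ elements ψ ℤ.* -1ℤ                  ∎)
    where
    lemma : ∀ x → x ℤ.* + 2 ≡ x ℤ.- x ℤ.* -1ℤ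
    lemma = solve-∀
    double : ∀ {x} → x ≡ x ℤ.* -1ℤ → x ≡ 0ℤ
    double {x} e with ℤₚ.i*j≡0⇒i≡0∨j≡0 x {+ 2} (trans (lemma x) (ℤₚ.i≡j⇒i-j≡0 e))
    ... | inj₁ x≡0 = x≡0

  -- Orthogonality, the detector of zero used twice: for the equation g α = β in the computation of
  -- δ, and for membership of a word in the code in `pless`.
  Σψ-scaled : ∀ c → Σ elements (λ x → ψ (x * c)) ≡ + q ℤ.* ind (c ≟ 0#)
  Σψ-scaled c with c ≟ 0#
  ... | yes refl = begin
    Σ elements (λ x → ψ (x * 0#))   ≡⟨ Σ-cong elements (λ x → trans (cong ψ (zeroʳ x)) ψ-0) ⟩
    Σ elements (λ _ → 1ℤ)           ≡⟨ Σ-const elements 1ℤ ⟩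
    + length elements ℤ.* 1ℤ        ≡⟨ cong (λ n → + n ℤ.* 1ℤ) card ⟩
    + q ℤ.* 1ℤ                      ∎
  ... | no c≢0 = begin
    Σ elements (λ x → ψ (x * c))    ≡⟨ Σ-cong elements (λ x → cong ψ (*-comm x c)) ⟩
    Σ elements (λ x → ψ (c * x))    ≡⟨ sym (Σ-map elements (c *_) ψ) ⟩
    Σ (map (c *_) elements) ψ       ≡⟨ Σ-↭ ψ (elements-↭ (c *_) (c ⁻¹ *_) (⁻¹-cancelˡ c≢0) (⁻¹-cancelʳ c≢0)) ⟩
    Σ elements ψ                    ≡⟨ Σψ≡0 ⟩
    0ℤ                              ≡⟨ sym (ℤₚ.*-zeroʳ (+ q)) ⟩
    + q ℤ.* 0ℤ                      ∎

  Σ-elements-split : ∀ f → Σ elements f ≡ f 0# ℤ.+ Σ nonzeros f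
  Σ-elements-split f = trans (Σ-↭ f elements-split) (Σ-∷ 0# nonzeros)

  Σ-nonzeros : ∀ f → Σ nonzeros f ≡ Σ elements f ℤ.+ -1ℤ ℤ.* f 0#
  Σ-nonzeros f = trans (lemma (f 0#) (Σ nonzeros f)) (cong (ℤ._+ (-1ℤ ℤ.* f 0#)) (sym (Σ-elements-split f)))
    where
    lemma : ∀ a b → b ≡ (a ℤ.+ b) ℤ.+ -1ℤ ℤ.* a
    lemma = solve-∀

  Σψ-nonzeros : ∀ c → Σ nonzeros (λ x → ψ (x * c)) ≡ + q ℤ.* ind (c ≟ 0#) ℤ.+ -1ℤ
  Σψ-nonzeros c = trans (Σ-nonzeros (λ x → ψ (x * c)))
    (cong₂ ℤ._+_ (Σψ-scaled c) (cong (-1ℤ ℤ.*_) (trans (cong ψ (zeroˡ c)) ψ-0)))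

  Σ-tuples-suc : ∀ m (f : Vec Carrier (suc m) → ℤ) →
    Σ (tuples (suc m)) f ≡ Σ nonzeros (λ a → Σ (tuples m) (λ α → f (a ∷ α)))
  Σ-tuples-suc m f = trans (Σ-concatMap nonzeros (λ a → map (a ∷_) (tuples m)) f)
    (Σ-cong nonzeros (λ a → Σ-map (tuples m) (a ∷_) f))

  Nonzero : ∀ {m} → Vec Carrier m → Set
  Nonzero = VecAll.All (_≢ 0#)

  Σ-tuples-cong : ∀ m {f g : Vec Carrier m → ℤ} → (∀ {α} → Nonzero α → f α ≡ g α) → Σ (tuples m) f ≡ Σ (tuples m) g
  Σ-tuples-cong zero    e = trans (Σ-singleton []) (trans (e VecAll.[]) (sym (Σ-singleton [])))
  Σ-tuples-cong (suc m) e = trans (Σ-tuples-suc m _)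
    (trans (Σ-cong∈ nonzeros (λ a∈ → Σ-tuples-cong m (λ nz → e (∈nonzeros a∈ VecAll.∷ nz)))) (sym (Σ-tuples-suc m _)))

  Σ-tuples-↭ : ∀ {σ} → map σ nonzeros ↭ nonzeros → ∀ m (f : Vec Carrier m → ℤ) →
    Σ (tuples m) (f ∘ Vec.map σ) ≡ Σ (tuples m) f
  Σ-tuples-↭ p zero f = trans (Σ-singleton []) (sym (Σ-singleton []))
  Σ-tuples-↭ {σ} p (suc m) f = begin
    Σ (tuples (suc m)) (f ∘ Vec.map σ)
      ≡⟨ Σ-tuples-suc m _ ⟩
    Σ nonzeros (λ a → Σ (tuples m) (λ α → f (σ a ∷ Vec.map σ α)))
      ≡⟨ Σ-cong nonzeros (λ a → Σ-tuples-↭ p m (λ α → f (σ a ∷ α))) ⟩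
    Σ nonzeros (λ a → Σ (tuples m) (λ α → f (σ a ∷ α)))
      ≡⟨ sym (Σ-map nonzeros σ _) ⟩
    Σ (map σ nonzeros) (λ a → Σ (tuples m) (λ α → f (a ∷ α)))
      ≡⟨ Σ-↭ _ p ⟩
    Σ nonzeros (λ a → Σ (tuples m) (λ α → f (a ∷ α)))
      ≡⟨ sym (Σ-tuples-suc m f) ⟩
    Σ (tuples (suc m)) f ∎

  length-nonzeros : length nonzeros ≡ q ∸ 1
  length-nonzeros = cong ℕ.pred card-nonzeros

  length-tuples : ∀ m → length (tuples m) ≡ (q ∸ 1) ℕ.^ m
  length-tuples m = ℤₚ.+-injective (trans (sym (ℤₚ.*-identityʳ _)) (trans (sym (Σ-const (tuples m) 1ℤ)) (count m)))
    where
    count : ∀ m → Σ (tuples m) (λ _ → 1ℤ) ≡ + ((q ∸ 1) ℕ.^ m)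
    count zero    = Σ-singleton []
    count (suc m) = begin
      Σ (tuples (suc m)) (λ _ → 1ℤ)                  ≡⟨ Σ-tuples-suc m (λ _ → 1ℤ) ⟩
      Σ nonzeros (λ _ → Σ (tuples m) (λ _ → 1ℤ))     ≡⟨ Σ-const nonzeros _ ⟩
      + length nonzeros ℤ.* Σ (tuples m) (λ _ → 1ℤ)  ≡⟨ cong₂ (λ n z → + n ℤ.* z) length-nonzeros (count m) ⟩
      + (q ∸ 1) ℤ.* + ((q ∸ 1) ℕ.^ m)                ≡⟨ sym (ℤₚ.pos-* (q ∸ 1) ((q ∸ 1) ℕ.^ m)) ⟩
      + ((q ∸ 1) ℕ.^ suc m)                          ∎

  sumV prodV⁻¹ : ∀ {m} → Vec Carrier m → Carrier
  sumV    α = sumF (toList α)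
  prodV⁻¹ α = prodF (map _⁻¹ (toList α))

  prodV⁻¹-nonzero : ∀ {m} {α : Vec Carrier m} → Nonzero α → prodV⁻¹ α ≢ 0#
  prodV⁻¹-nonzero VecAll.[]        = 0≢1 ∘ sym
  prodV⁻¹-nonzero (nz VecAll.∷ ns) = *-nonzero (⁻¹-nonzero nz) (prodV⁻¹-nonzero ns)

  sumV-scale : ∀ c {m} (α : Vec Carrier m) → sumV (Vec.map (c *_) α) ≡ c * sumV α
  sumV-scale c []      = sym (zeroʳ c)
  sumV-scale c (a ∷ α) = trans (cong (λ z → (c * a) + z) (sumV-scale c α)) (sym (distribˡ c a (sumV α)))

  *-interchange : ∀ a b c d → (a * b) * (c * d) ≡ (a * c) * (b * d)
  *-interchange a b c d = begin
    (a * b) * (c * d)   ≡⟨ *-assoc a b _ ⟩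
    a * (b * (c * d))   ≡⟨ cong (a *_) (trans (sym (*-assoc b c d)) (trans (cong (_* d) (*-comm b c)) (*-assoc c b d))) ⟩
    a * (c * (b * d))   ≡⟨ sym (*-assoc a c _) ⟩
    (a * c) * (b * d)   ∎

  -- Keeping the power of c as a factor avoids inverting it; one further factor from x g(α) gives
  -- the exponent m + 1 of `Σψ-scaled-g`.
  prodV⁻¹-scale : ∀ {c} → c ≢ 0# → ∀ {m} {α : Vec Carrier m} → Nonzero α →
    pow c m * prodV⁻¹ (Vec.map (c *_) α) ≡ prodV⁻¹ α
  prodV⁻¹-scale c≢0 VecAll.[] = *-identityˡ 1#
  prodV⁻¹-scale {c} c≢0 {suc m} {a ∷ α} (nz VecAll.∷ ns) = begin
    (c * pow c m) * ((c * a) ⁻¹ * prodV⁻¹ (Vec.map (c *_) α))   ≡⟨ *-interchange c (pow c m) _ _ ⟩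
    (c * (c * a) ⁻¹) * (pow c m * prodV⁻¹ (Vec.map (c *_) α))   ≡⟨ cong₂ _*_ (trans (cong (c *_) (⁻¹-distrib-* c≢0 nz)) (⁻¹-cancelʳ c≢0 _)) (prodV⁻¹-scale c≢0 ns) ⟩
    a ⁻¹ * prodV⁻¹ α                                            ∎

  sumV-square : ∀ {m} (α : Vec Carrier m) → sumV (Vec.map square α) ≡ square (sumV α)
  sumV-square []      = sym (zeroˡ 0#)
  sumV-square (a ∷ α) = trans (cong (λ z → square a + z) (sumV-square α)) (sym (square-+ a (sumV α)))

  prodV⁻¹-square : ∀ {m} {α : Vec Carrier m} → Nonzero α → prodV⁻¹ (Vec.map square α) ≡ square (prodV⁻¹ α)
  prodV⁻¹-square VecAll.[]                    = sym (*-identityˡ 1#)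
  prodV⁻¹-square {α = a ∷ α} (nz VecAll.∷ ns) =
    trans (cong₂ _*_ (⁻¹-distrib-* nz nz) (prodV⁻¹-square ns)) (*-interchange _ _ _ _)

  K-Σ : ∀ m a → K r m a ≡ Σ (tuples m) (λ α → ψ (sumV α + a * prodV⁻¹ α))
  K-Σ m a = trans (sym (Σ-def (tuples m) _)) (Σ-cong (tuples m) (λ α → ψ-def _))

  -- the inverse of squaring is x ↦ x^(q/2)
  square-↭ : map square nonzeros ↭ nonzeros
  square-↭ = nonzeros-↭ square (frob k)
    (λ x → trans (frob-square k x) (root x)) root
    (λ x≢0 → *-nonzero x≢0 x≢0) (λ x≢0 → pow-nonzero x≢0 (2 ℕ.^ k))
    where
    root : ∀ x → square (frob k x) ≡ x
    root x = trans (sym (frob-suc k x)) (trans (cong (λ n → frob n x) (sym r≡1+k)) (frob-r x))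

  -- Squaring all coordinates permutes the tuples, and squaring is additive in characteristic 2. The
  -- whole argument of ψ thereby becomes a square, which ψ does not distinguish from its root.
  K-square : ∀ m a → K r m (square a) ≡ K r m a
  K-square m a = begin
    K r m (square a)
      ≡⟨ K-Σ m (square a) ⟩
    Σ (tuples m) (λ α → ψ (sumV α + square a * prodV⁻¹ α))
      ≡⟨ sym (Σ-tuples-↭ square-↭ m _) ⟩
    Σ (tuples m) (λ α → ψ (sumV (Vec.map square α) + square a * prodV⁻¹ (Vec.map square α)))
      ≡⟨ Σ-tuples-cong m (λ {α} nz → trans (cong ψ (trans
           (cong₂ _+_ (sumV-square α) (trans (cong (square a *_) (prodV⁻¹-square nz)) (sym (square-* a (prodV⁻¹ α)))))
           (sym (square-+ (sumV α) (a * prodV⁻¹ α))))) (ψ-square _)) ⟩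
    Σ (tuples m) (λ α → ψ (sumV α + a * prodV⁻¹ α))
      ≡⟨ sym (K-Σ m a) ⟩
    K r m a ∎

  K-frob : ∀ m i a → K r m (frob i a) ≡ K r m a
  K-frob m zero    a = cong (K r m) (*-identityʳ a)
  K-frob m (suc i) a = trans (cong (K r m) (frob-suc i a)) (trans (K-square m (frob i a)) (K-frob m i a))

  -- Scaling all coordinates by x turns x(Σα + ∏α⁻¹) into Σα + x^(m+1) ∏α⁻¹,
  -- and x^(m+1) is a Frobenius conjugate of x.
  Σψ-scaled-g : ∀ m s → suc m ≡ 2 ℕ.^ s → ∀ {x} → x ≢ 0# → Σ (tuples m) (λ α → ψ (x * g α)) ≡ K r m x
  Σψ-scaled-g m s e {x} x≢0 = begin
    Σ (tuples m) (λ α → ψ (x * g α))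
      ≡⟨ Σ-tuples-cong m (λ {α} nz → cong ψ (scaled nz)) ⟩
    Σ (tuples m) (λ α → ψ (sumV (Vec.map (x *_) α) + pow x (suc m) * prodV⁻¹ (Vec.map (x *_) α)))
      ≡⟨ Σ-tuples-↭ (scale-↭ x≢0) m (λ α → ψ (sumV α + pow x (suc m) * prodV⁻¹ α)) ⟩
    Σ (tuples m) (λ α → ψ (sumV α + pow x (suc m) * prodV⁻¹ α))
      ≡⟨ sym (K-Σ m _) ⟩
    K r m (pow x (suc m))
      ≡⟨ cong (λ n → K r m (pow x n)) e ⟩
    K r m (frob s x)
      ≡⟨ K-frob m s x ⟩
    K r m x ∎
    where
    scaled : ∀ {α} → Nonzero α → x * g α ≡ sumV (Vec.map (x *_) α) + pow x (suc m) * prodV⁻¹ (Vec.map (x *_) α)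
    scaled {α} nz = trans (distribˡ x _ _) (cong₂ _+_ (sym (sumV-scale x α))
      (sym (trans (*-assoc x _ _) (cong (x *_) (prodV⁻¹-scale x≢0 nz)))))

  -- The sum factors over the coordinates, and each factor is -1: the full character sum 0 without
  -- its term ψ 0 = 1.
  Σψ-sumV : ∀ m → Σ (tuples m) (ψ ∘ sumV) ≡ sgn m
  Σψ-sumV zero    = trans (Σ-singleton []) ψ-0
  Σψ-sumV (suc m) = begin
    Σ (tuples (suc m)) (ψ ∘ sumV)
      ≡⟨ Σ-tuples-suc m _ ⟩
    Σ nonzeros (λ a → Σ (tuples m) (λ α → ψ (a + sumV α)))
      ≡⟨ Σ-cong nonzeros (λ a → trans (Σ-cong (tuples m) (λ α → ψ-+ a (sumV α)))
           (trans (Σ-*ˡ (tuples m) (ψ a) _) (cong₂ ℤ._*_ (cong ψ (sym (*-identityʳ a))) (Σψ-sumV m)))) ⟩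
    Σ nonzeros (λ a → ψ (a * 1#) ℤ.* sgn m)
      ≡⟨ Σ-*ʳ nonzeros (sgn m) _ ⟩
    Σ nonzeros (λ a → ψ (a * 1#)) ℤ.* sgn m
      ≡⟨ cong (ℤ._* sgn m) (trans (Σψ-nonzeros 1#)
           (cong (λ z → + q ℤ.* z ℤ.+ -1ℤ) (ind-no (1# ≟ 0#) (0≢1 ∘ sym)))) ⟩
    (+ q ℤ.* 0ℤ ℤ.+ -1ℤ) ℤ.* sgn m
      ≡⟨ cong (λ z → (z ℤ.+ -1ℤ) ℤ.* sgn m) (ℤₚ.*-zeroʳ (+ q)) ⟩
    sgn (suc m) ∎

  -- The part of δ that depends on β. It is empty for β = 0; for β ≠ 0 the constraint eliminates one
  -- coordinate and leaves a Kloosterman sum of one dimension less.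
  sumOver : ∀ m → Carrier → ℤ
  sumOver m β = Σ (tuples m) (λ α → ψ (sumV α) ℤ.* ind (prodV⁻¹ α ≟ β))

  -- Detect g α = β by characters. The frequency x = 0 counts all tuples. For x ≠ 0, replacing Σ ψ(x
  -- g(α)) by K_m(x) removes x from the sum of the coordinates and leaves it only before the product
  -- of inverses, so summing over x now forces that product to equal β.
  δ-character-sum : ∀ m s → 1 ≤ s → suc m ≡ 2 ℕ.^ s → ∀ β →
    + q ℤ.* + δ m β ≡ + q ℤ.* sumOver m β ℤ.+ + ((q ∸ 1) ℕ.^ m ℕ.+ 1)
  δ-character-sum m s 1≤s e β = begin
    + q ℤ.* + δ m β
      ≡⟨ cong (+ q ℤ.*_) (length-filter (λ α → g α ≟ β) (tuples m)) ⟩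
    + q ℤ.* Σ (tuples m) (λ α → ind (g α ≟ β))
      ≡⟨ sym (Σ-*ˡ (tuples m) (+ q) _) ⟩
    Σ (tuples m) (λ α → + q ℤ.* ind (g α ≟ β))
      ≡⟨ Σ-cong (tuples m) (λ α → trans
           (cong (+ q ℤ.*_) (ind-cong (g α ≟ β) ((g α + β) ≟ 0#) (shift _) x+y≡0⇒x≡y))
           (sym (Σψ-scaled (g α + β)))) ⟩
    Σ (tuples m) (λ α → Σ elements (λ x → ψ (x * (g α + β))))
      ≡⟨ Σ-swap (tuples m) elements _ ⟩
    Σ elements (λ x → Σ (tuples m) (λ α → ψ (x * (g α + β))))
      ≡⟨ Σ-elements-split _ ⟩
    Σ (tuples m) (λ α → ψ (0# * (g α + β))) ℤ.+ Σ nonzeros (λ x → Σ (tuples m) (λ α → ψ (x * (g α + β))))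
      ≡⟨ cong₂ ℤ._+_ at-zero off-zero ⟩
    + N ℤ.+ (+ q ℤ.* sumOver m β ℤ.+ 1ℤ)
      ≡⟨ trans (lemma (+ N) (+ q ℤ.* sumOver m β)) (cong (λ z → + q ℤ.* sumOver m β ℤ.+ z) (sym (ℤₚ.pos-+ N 1))) ⟩
    + q ℤ.* sumOver m β ℤ.+ + (N ℕ.+ 1) ∎
    where
    N = (q ∸ 1) ℕ.^ m
    lemma : ∀ n a → n ℤ.+ (a ℤ.+ 1ℤ) ≡ a ℤ.+ (n ℤ.+ 1ℤ)
    lemma = solve-∀
    shift : ∀ y {x} → x ≡ y → x + y ≡ 0#
    shift y refl = x+x≡0 y
    at-zero : Σ (tuples m) (λ α → ψ (0# * (g α + β))) ≡ + N
    at-zero = begin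
      Σ (tuples m) (λ α → ψ (0# * (g α + β)))   ≡⟨ Σ-cong (tuples m) (λ α → trans (cong ψ (zeroˡ _)) ψ-0) ⟩
      Σ (tuples m) (λ _ → 1ℤ)                   ≡⟨ Σ-const (tuples m) 1ℤ ⟩
      + length (tuples m) ℤ.* 1ℤ                ≡⟨ trans (ℤₚ.*-identityʳ _) (cong +_ (length-tuples m)) ⟩
      + N                                       ∎
    expand : ∀ x s p → ψ (s + x * p) ℤ.* ψ (x * β) ≡ ψ s ℤ.* ψ (x * (p + β))
    expand x s p = begin
      ψ (s + x * p) ℤ.* ψ (x * β)             ≡⟨ cong (ℤ._* ψ (x * β)) (ψ-+ s (x * p)) ⟩
      (ψ s ℤ.* ψ (x * p)) ℤ.* ψ (x * β)       ≡⟨ ℤₚ.*-assoc (ψ s) _ _ ⟩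
      ψ s ℤ.* (ψ (x * p) ℤ.* ψ (x * β))       ≡⟨ cong (ψ s ℤ.*_) (trans (sym (ψ-+ (x * p) (x * β))) (cong ψ (sym (distribˡ x p β)))) ⟩
      ψ s ℤ.* ψ (x * (p + β))                 ∎
    off-zero : Σ nonzeros (λ x → Σ (tuples m) (λ α → ψ (x * (g α + β)))) ≡ + q ℤ.* sumOver m β ℤ.+ 1ℤ
    off-zero = begin
      Σ nonzeros (λ x → Σ (tuples m) (λ α → ψ (x * (g α + β))))
        ≡⟨ Σ-cong∈ nonzeros (λ {x} x∈ → begin
             Σ (tuples m) (λ α → ψ (x * (g α + β)))
               ≡⟨ Σ-cong (tuples m) (λ α → trans (cong ψ (distribˡ x (g α) β)) (ψ-+ (x * g α) (x * β))) ⟩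
             Σ (tuples m) (λ α → ψ (x * g α) ℤ.* ψ (x * β))
               ≡⟨ Σ-*ʳ (tuples m) (ψ (x * β)) _ ⟩
             Σ (tuples m) (λ α → ψ (x * g α)) ℤ.* ψ (x * β)
               ≡⟨ cong (ℤ._* ψ (x * β)) (trans (Σψ-scaled-g m s e (∈nonzeros x∈)) (K-Σ m x)) ⟩
             Σ (tuples m) (λ α → ψ (sumV α + x * prodV⁻¹ α)) ℤ.* ψ (x * β)
               ≡⟨ sym (Σ-*ʳ (tuples m) (ψ (x * β)) _) ⟩
             Σ (tuples m) (λ α → ψ (sumV α + x * prodV⁻¹ α) ℤ.* ψ (x * β))
               ≡⟨ Σ-cong (tuples m) (λ α → expand x (sumV α) (prodV⁻¹ α)) ⟩
             Σ (tuples m) (λ α → ψ (sumV α) ℤ.* ψ (x * (prodV⁻¹ α + β))) ∎) ⟩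
      Σ nonzeros (λ x → Σ (tuples m) (λ α → ψ (sumV α) ℤ.* ψ (x * (prodV⁻¹ α + β))))
        ≡⟨ Σ-swap nonzeros (tuples m) _ ⟩
      Σ (tuples m) (λ α → Σ nonzeros (λ x → ψ (sumV α) ℤ.* ψ (x * (prodV⁻¹ α + β))))
        ≡⟨ Σ-cong (tuples m) (λ α → trans (Σ-*ˡ nonzeros (ψ (sumV α)) _) (trans
             (cong (ψ (sumV α) ℤ.*_) (trans (Σψ-nonzeros (prodV⁻¹ α + β)) (cong (λ z → + q ℤ.* z ℤ.+ -1ℤ)
                (ind-cong ((prodV⁻¹ α + β) ≟ 0#) (prodV⁻¹ α ≟ β) x+y≡0⇒x≡y (shift β)))))
             (distribute (ψ (sumV α)) (+ q) (ind (prodV⁻¹ α ≟ β))))) ⟩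
      Σ (tuples m) (λ α → + q ℤ.* (ψ (sumV α) ℤ.* ind (prodV⁻¹ α ≟ β)) ℤ.+ -1ℤ ℤ.* ψ (sumV α))
        ≡⟨ trans (Σ-+ (tuples m) _ _) (cong₂ ℤ._+_ (Σ-*ˡ (tuples m) (+ q) _) (Σ-*ˡ (tuples m) -1ℤ _)) ⟩
      + q ℤ.* sumOver m β ℤ.+ -1ℤ ℤ.* Σ (tuples m) (ψ ∘ sumV)
        -- The second sum over x omits x = 0, which costs -(-1)^m; since m is odd, this is +1.
        ≡⟨ cong (λ z → + q ℤ.* sumOver m β ℤ.+ -1ℤ ℤ.* z) (trans (Σψ-sumV m) (sgn-2^∸1 s 1≤s e)) ⟩
      + q ℤ.* sumOver m β ℤ.+ 1ℤ ∎
      where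
      distribute : ∀ p q i → p ℤ.* (q ℤ.* i ℤ.+ -1ℤ) ≡ q ℤ.* (p ℤ.* i) ℤ.+ -1ℤ ℤ.* p
      distribute = solve-∀

  sumOver-zero : ∀ m → sumOver m 0# ≡ 0ℤ
  sumOver-zero m = trans
    (Σ-tuples-cong m (λ {α} nz → trans (cong (ψ (sumV α) ℤ.*_) (ind-no (prodV⁻¹ α ≟ 0#) (prodV⁻¹-nonzero nz))) (ℤₚ.*-zeroʳ (ψ (sumV α)))))
    (Σ-0 (tuples m) (λ _ → refl))

  -- With p the product of the remaining inverses, the constraint a⁻¹ p = β has the single solution
  -- a = β⁻¹ p. Substituting it gives the exponent of the Kloosterman sum at β⁻¹.
  sumOver-nonzero : ∀ m {β} → β ≢ 0# → sumOver (suc m) β ≡ K r m (β ⁻¹)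
  sumOver-nonzero m {β} β≢0 = begin
    sumOver (suc m) β
      ≡⟨ Σ-tuples-suc m _ ⟩
    Σ nonzeros (λ a → Σ (tuples m) (λ α → ψ (a + sumV α) ℤ.* ind ((a ⁻¹ * prodV⁻¹ α) ≟ β)))
      ≡⟨ Σ-swap nonzeros (tuples m) _ ⟩
    Σ (tuples m) (λ α → Σ nonzeros (λ a → ψ (a + sumV α) ℤ.* ind ((a ⁻¹ * prodV⁻¹ α) ≟ β)))
      ≡⟨ Σ-tuples-cong m (λ {α} nz → pick (sumV α) (prodV⁻¹-nonzero nz)) ⟩
    Σ (tuples m) (λ α → ψ (sumV α + β ⁻¹ * prodV⁻¹ α))
      ≡⟨ sym (K-Σ m (β ⁻¹)) ⟩
    K r m (β ⁻¹) ∎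
    where
    pick : ∀ s {p} → p ≢ 0# → Σ nonzeros (λ a → ψ (a + s) ℤ.* ind ((a ⁻¹ * p) ≟ β)) ≡ ψ (s + β ⁻¹ * p)
    pick s {p} p≢0 = trans
      (Σ-single _ nonzeros-unique (nonzero∈ c≢0) (λ {a} a∈ a≢c →
        trans (cong (ψ (a + s) ℤ.*_) (ind-no ((a ⁻¹ * p) ≟ β) (λ e → a≢c (solve-a (∈nonzeros a∈) e)))) (ℤₚ.*-zeroʳ (ψ (a + s)))))
      (trans (cong (ψ (β ⁻¹ * p + s) ℤ.*_) (ind-yes (((β ⁻¹ * p) ⁻¹ * p) ≟ β) c-solves))
        (trans (ℤₚ.*-identityʳ _) (cong ψ (+-comm _ s))))
      where
      c≢0 : β ⁻¹ * p ≢ 0#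
      c≢0 = *-nonzero (⁻¹-nonzero β≢0) p≢0
      solve-a : ∀ {a} → a ≢ 0# → a ⁻¹ * p ≡ β → a ≡ β ⁻¹ * p
      solve-a {a} a≢0 e = *-cancelˡ β≢0 (begin
        β * a            ≡⟨ *-comm β a ⟩
        a * β            ≡⟨ cong (a *_) (sym e) ⟩
        a * (a ⁻¹ * p)   ≡⟨ ⁻¹-cancelʳ a≢0 p ⟩
        p                ≡⟨ sym (⁻¹-cancelʳ β≢0 p) ⟩
        β * (β ⁻¹ * p)   ∎)
      c-solves : (β ⁻¹ * p) ⁻¹ * p ≡ β
      c-solves = *-cancelˡ c≢0 (trans (⁻¹-cancelʳ c≢0 p) (sym (begin
        (β ⁻¹ * p) * β   ≡⟨ *-comm _ β ⟩
        β * (β ⁻¹ * p)   ≡⟨ ⁻¹-cancelʳ β≢0 p ⟩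
        p                ∎)))

  δ-zero : ∀ m s → 1 ≤ s → suc m ≡ 2 ℕ.^ s → q ℕ.* δ m 0# ≡ (q ∸ 1) ℕ.^ m ℕ.+ 1
  δ-zero m s 1≤s e = ℤₚ.+-injective (begin
    + (q ℕ.* δ m 0#)
      ≡⟨ ℤₚ.pos-* q (δ m 0#) ⟩
    + q ℤ.* + δ m 0#
      ≡⟨ δ-character-sum m s 1≤s e 0# ⟩
    + q ℤ.* sumOver m 0# ℤ.+ + ((q ∸ 1) ℕ.^ m ℕ.+ 1)
      ≡⟨ cong (ℤ._+ + ((q ∸ 1) ℕ.^ m ℕ.+ 1)) (trans (cong (+ q ℤ.*_) (sumOver-zero m)) (ℤₚ.*-zeroʳ (+ q))) ⟩
    0ℤ ℤ.+ + ((q ∸ 1) ℕ.^ m ℕ.+ 1)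
      ≡⟨ ℤₚ.+-identityˡ _ ⟩
    + ((q ∸ 1) ℕ.^ m ℕ.+ 1) ∎)

  δ-nonzero : ∀ m s → 1 ≤ s → suc (suc m) ≡ 2 ℕ.^ s → ∀ {β} → β ≢ 0# →
    + (q ℕ.* δ (suc m) β) ≡ + q ℤ.* K r m (β ⁻¹) ℤ.+ + ((q ∸ 1) ℕ.^ suc m ℕ.+ 1)
  δ-nonzero m s 1≤s e {β} β≢0 = trans (ℤₚ.pos-* q (δ (suc m) β)) (trans (δ-character-sum (suc m) s 1≤s e β)
    (cong (λ z → + q ℤ.* z ℤ.+ + ((q ∸ 1) ℕ.^ suc m ℕ.+ 1)) (sumOver-nonzero m β≢0)))

-- The weight distribution of the code.

module WeightDistribution (F : FiniteField) where
  open FiniteField F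
  open FF F
  open FieldTheory F
  open ℤΣ
  open IntegerSums
  open BinomialSums using (pascal)
  open import Data.Integer using (+_)
  open ≡-Reasoning

  Σ-boolVecs-suc : ∀ k (f : Vec _ (suc k) → ℤ) →
    Σ (boolVecs (suc k)) f ≡ Σ (boolVecs k) (f ∘ (true ∷_)) ℤ.+ Σ (boolVecs k) (f ∘ (false ∷_))
  Σ-boolVecs-suc k f = trans (Σ-concatMap (true ∷ false ∷ []) (λ b → map (b ∷_) (boolVecs k)) f)
    (trans (Σ-∷ true _) (cong₂ ℤ._+_ (Σ-map (boolVecs k) _ f) (trans (Σ-singleton false) (Σ-map (boolVecs k) _ f))))

  -- Both sides of the weight formula are evaluated against a test function φ of
  -- (weight, syndrome), which turns them into the same recursion over the word.
  Test : Set
  Test = ℕ → Carrier → ℤ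

  wordSum : ∀ {k} → Vec Carrier k → Test → ℤ
  wordSum {k} v φ = Σ (boolVecs k) (λ u → φ (weight u) (dot u v))

  -- Here `f b` is the number of positions with entry b, of which ν are chosen. The sum over
  -- families is nested value by value, and the test function absorbs the weight and syndrome
  -- collected so far.
  multisetSum : (Carrier → ℕ) → List Carrier → Test → ℤ
  multisetSum f []       φ = φ 0 0#
  multisetSum f (b ∷ bs) φ =
    Σ (upTo (suc (f b))) (λ ν → + (f b C ν) ℤ.* multisetSum f bs (λ j c → φ (ν ℕ.+ j) (nmul ν b + c)))

  multisetSum-cong : ∀ {f f′} bs {φ φ′ : Test} → (∀ {b} → b ∈ bs → f b ≡ f′ b) → (∀ j c → φ j c ≡ φ′ j c) →
    multisetSum f bs φ ≡ multisetSum f′ bs φ′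
  multisetSum-cong []       e e′ = e′ 0 0#
  multisetSum-cong {f} {f′} (b ∷ bs) {φ} {φ′} e e′ = trans
    (Σ-cong (upTo (suc (f b))) (λ ν → cong (+ (f b C ν) ℤ.*_) (multisetSum-cong bs (e ∘ there) (λ j c → e′ _ _))))
    (cong (λ n → Σ (upTo (suc n)) (λ ν → + (n C ν) ℤ.* multisetSum f′ bs (λ j c → φ′ (ν ℕ.+ j) (nmul ν b + c)))) (e (here refl)))

  -- Pascal's rule at the one level where x occurs; the other levels only pass the splitting
  -- through. The two summands correspond to using or not using the additional position with entry
  -- x.
  multisetSum-insert : ∀ {f f′ x} bs → Unique bs → x ∈ bs → f′ x ≡ suc (f x) → (∀ {y} → y ≢ x → f′ y ≡ f y) → ∀ φ →
    multisetSum f′ bs φ ≡ multisetSum f bs (λ j c → φ (suc j) (x + c)) ℤ.+ multisetSum f bs φ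
  multisetSum-insert {f} {f′} {x} (_ ∷ bs) (x∉ ∷ u) (here refl) e e′ φ = begin
    Σ (upTo (suc (f′ x))) (λ ν → + (f′ x C ν) ℤ.* multisetSum f′ bs (λ j c → φ (ν ℕ.+ j) (nmul ν x + c)))
      ≡⟨ cong (λ n → Σ (upTo (suc n)) (λ ν → + (n C ν) ℤ.* multisetSum f′ bs (λ j c → φ (ν ℕ.+ j) (nmul ν x + c)))) e ⟩
    Σ (upTo (suc (suc (f x)))) (λ ν → + (suc (f x) C ν) ℤ.* multisetSum f′ bs (λ j c → φ (ν ℕ.+ j) (nmul ν x + c)))
      ≡⟨ Σ-cong (upTo (suc (suc (f x)))) (λ ν → cong (+ (suc (f x) C ν) ℤ.*_)
           (multisetSum-cong bs (λ b∈ → e′ (≢-sym (All.lookup x∉ b∈))) (λ _ _ → refl))) ⟩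
    Σ (upTo (suc (suc (f x)))) (λ ν → + (suc (f x) C ν) ℤ.* multisetSum f bs (λ j c → φ (ν ℕ.+ j) (nmul ν x + c)))
      ≡⟨ pascal (f x) (λ ν → multisetSum f bs (λ j c → φ (ν ℕ.+ j) (nmul ν x + c))) ⟩
    multisetSum f (x ∷ bs) φ
      ℤ.+ Σ (upTo (suc (f x))) (λ ν → + (f x C ν) ℤ.* multisetSum f bs (λ j c → φ (suc ν ℕ.+ j) ((x + nmul ν x) + c)))
      ≡⟨ ℤₚ.+-comm (multisetSum f (x ∷ bs) φ) _ ⟩
    Σ (upTo (suc (f x))) (λ ν → + (f x C ν) ℤ.* multisetSum f bs (λ j c → φ (suc ν ℕ.+ j) ((x + nmul ν x) + c)))
      ℤ.+ multisetSum f (x ∷ bs) φ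
      ≡⟨ cong (ℤ._+ multisetSum f (x ∷ bs) φ) (Σ-cong (upTo (suc (f x))) (λ ν → cong (+ (f x C ν) ℤ.*_)
           (multisetSum-cong bs (λ _ → refl) (λ j c → cong (φ (suc (ν ℕ.+ j))) (+-assoc x (nmul ν x) c))))) ⟩
    multisetSum f (x ∷ bs) (λ j c → φ (suc j) (x + c)) ℤ.+ multisetSum f (x ∷ bs) φ ∎
  multisetSum-insert {f} {f′} {x} (b ∷ bs) (b∉ ∷ u) (there x∈) e e′ φ = begin
    Σ (upTo (suc (f′ b))) (λ ν → + (f′ b C ν) ℤ.* multisetSum f′ bs (λ j c → φ (ν ℕ.+ j) (nmul ν b + c)))
      ≡⟨ cong (λ n → Σ (upTo (suc n)) (λ ν → + (n C ν) ℤ.* multisetSum f′ bs (λ j c → φ (ν ℕ.+ j) (nmul ν b + c)))) (e′ (All.lookup b∉ x∈)) ⟩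
    Σ (upTo (suc (f b))) (λ ν → + (f b C ν) ℤ.* multisetSum f′ bs (λ j c → φ (ν ℕ.+ j) (nmul ν b + c)))
      ≡⟨ Σ-cong (upTo (suc (f b))) (λ ν → trans
           (cong (+ (f b C ν) ℤ.*_) (trans (multisetSum-insert bs u x∈ e e′ _)
             (cong (ℤ._+ multisetSum f bs (λ j c → φ (ν ℕ.+ j) (nmul ν b + c)))
               (multisetSum-cong bs (λ _ → refl) (λ j c → cong₂ φ (ℕₚ.+-suc ν j) (swap (nmul ν b) x c))))))
           (ℤₚ.*-distribˡ-+ (+ (f b C ν)) _ _)) ⟩
    Σ (upTo (suc (f b))) (λ ν →
      + (f b C ν) ℤ.* multisetSum f bs (λ j c → φ (suc (ν ℕ.+ j)) (x + (nmul ν b + c)))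
        ℤ.+ + (f b C ν) ℤ.* multisetSum f bs (λ j c → φ (ν ℕ.+ j) (nmul ν b + c)))
      ≡⟨ Σ-+ (upTo (suc (f b))) _ _ ⟩
    multisetSum f (b ∷ bs) (λ j c → φ (suc j) (x + c)) ℤ.+ multisetSum f (b ∷ bs) φ ∎
    where
    swap : ∀ p q s → p + (q + s) ≡ q + (p + s)
    swap p q s = trans (sym (+-assoc p q s)) (trans (cong (_+ s) (+-comm p q)) (+-assoc q p s))

  multisetSum-empty : ∀ {f} bs → (∀ b → f b ≡ 0) → ∀ φ → multisetSum f bs φ ≡ φ 0 0#
  multisetSum-empty []       e φ = refl
  multisetSum-empty {f} (b ∷ bs) e φ = begin
    multisetSum f (b ∷ bs) φ
      ≡⟨ cong (λ n → Σ (upTo (suc n)) (λ ν → + (n C ν) ℤ.* multisetSum f bs (λ j c → φ (ν ℕ.+ j) (nmul ν b + c)))) (e b) ⟩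
    Σ (upTo 1) (λ ν → + (0 C ν) ℤ.* multisetSum f bs (λ j c → φ (ν ℕ.+ j) (nmul ν b + c)))
      ≡⟨ trans (Σ-singleton 0) (ℤₚ.*-identityˡ _) ⟩
    multisetSum f bs (λ j c → φ j (0# + c))
      ≡⟨ multisetSum-empty bs e _ ⟩
    φ 0 (0# + 0#)
      ≡⟨ cong (φ 0) (+-identityˡ 0#) ⟩
    φ 0 0# ∎

  wordSum-∷ : ∀ x {k} (v : Vec Carrier k) φ →
    wordSum (x ∷ v) φ ≡ wordSum v (λ j c → φ (suc j) (x + c)) ℤ.+ wordSum v φ
  wordSum-∷ x {k} v φ = Σ-boolVecs-suc k _

  -- Stated for any list `L` so that induction can shorten the word while the values still range
  -- over all of `elements`. Adding a position acts by `wordSum-∷` on one side and by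
  -- `multisetSum-insert` on the other, with identical effect.
  wordSum≡multisetSum : ∀ {B : Set} (h : B → Carrier) (L : List B) φ →
    wordSum (fromList (map h L)) φ ≡ multisetSum (λ β → length (filter (λ y → h y ≟ β) L)) elements φ
  wordSum≡multisetSum h []      φ = trans (Σ-singleton []) (sym (multisetSum-empty elements (λ _ → refl) φ))
  wordSum≡multisetSum h (y ∷ L) φ = begin
    wordSum (h y ∷ fromList (map h L)) φ
      ≡⟨ wordSum-∷ (h y) (fromList (map h L)) φ ⟩
    wordSum (fromList (map h L)) (λ j c → φ (suc j) (h y + c)) ℤ.+ wordSum (fromList (map h L)) φ
      ≡⟨ cong₂ ℤ._+_ (wordSum≡multisetSum h L _) (wordSum≡multisetSum h L φ) ⟩
    multisetSum (count L) elements (λ j c → φ (suc j) (h y + c)) ℤ.+ multisetSum (count L) elements φ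
      ≡⟨ sym (multisetSum-insert elements elements-unique (elements-complete (h y))
           (cong length (filter-accept (λ z → h z ≟ h y) refl))
           (λ {β} β≢ → cong length (filter-reject (λ z → h z ≟ β) (β≢ ∘ sym))) φ) ⟩
    multisetSum (count (y ∷ L)) elements φ ∎
    where
    count : List _ → Carrier → ℕ
    count M β = length (filter (λ z → h z ≟ β) M)

  familyCount : ℕ → List (Carrier × ℕ) → ℕ
  familyCount m f = product (map (λ p → δ m (proj₁ p) C proj₂ p) f)

  Σ-families : ∀ m bs φ →
    Σ (families m bs) (λ f → + familyCount m f ℤ.* φ (famSize f) (famWeightedSum f)) ≡ multisetSum (δ m) bs φ
  Σ-families m []       φ = trans (Σ-singleton []) (ℤₚ.*-identityˡ _)
  Σ-families m (b ∷ bs) φ = begin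
    Σ (families m (b ∷ bs)) (λ f → + familyCount m f ℤ.* φ (famSize f) (famWeightedSum f))
      ≡⟨ Σ-concatMap (upTo (suc (δ m b))) _ _ ⟩
    Σ (upTo (suc (δ m b))) (λ ν → Σ (map ((b , ν) ∷_) (families m bs)) (λ f → + familyCount m f ℤ.* φ (famSize f) (famWeightedSum f)))
      ≡⟨ Σ-cong (upTo (suc (δ m b))) (λ ν → trans (Σ-map (families m bs) ((b , ν) ∷_) _) (trans
           (Σ-cong (families m bs) (λ f → trans
             (cong (ℤ._* φ (ν ℕ.+ famSize f) (nmul ν b + famWeightedSum f)) (ℤₚ.pos-* (δ m b C ν) (familyCount m f)))
             (ℤₚ.*-assoc (+ (δ m b C ν)) _ _)))
           (trans (Σ-*ˡ (families m bs) (+ (δ m b C ν)) _) (cong (+ (δ m b C ν) ℤ.*_) (Σ-families m bs _))))) ⟩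
    multisetSum (δ m) (b ∷ bs) φ ∎

  pos-sum : ∀ {B : Set} (L : List B) (h : B → ℕ) → + sum (map h L) ≡ Σ L (λ x → + h x)
  pos-sum []      h = sym Σ-[]
  pos-sum (x ∷ L) h = trans (ℤₚ.pos-+ (h x) _) (trans (cong (λ z → + h x ℤ.+ z) (pos-sum L h)) (sym (Σ-∷ x L)))

  Cw-wordSum : ∀ m j → + Cw m j ≡ wordSum (fromList (gs m)) (λ i c → ind ((i ℕ.≟ j) ×-dec (c ≟ 0#)))
  Cw-wordSum m j = length-filter _ (boolVecs (length (gs m)))

  Cw≡CwFormula : ∀ m j → Cw m j ≡ CwFormula m j
  Cw≡CwFormula m j = ℤₚ.+-injective (begin
    + Cw m j
      ≡⟨ Cw-wordSum m j ⟩
    wordSum (fromList (gs m)) φ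
      ≡⟨ wordSum≡multisetSum g (tuples m) φ ⟩
    multisetSum (δ m) elements φ
      ≡⟨ sym (Σ-families m elements φ) ⟩
    Σ (families m elements) (λ f → + familyCount m f ℤ.* φ (famSize f) (famWeightedSum f))
      ≡⟨ Σ-cong (families m elements) (λ f → ℤₚ.*-comm (+ familyCount m f) _) ⟩
    Σ (families m elements) (λ f → φ (famSize f) (famWeightedSum f) ℤ.* + familyCount m f)
      ≡⟨ sym (Σ-filter _ (families m elements) _) ⟩
    Σ admissible (λ f → + familyCount m f)
      ≡⟨ sym (pos-sum admissible (familyCount m)) ⟩
    + sum (map (familyCount m) admissible)
      ≡⟨ cong (λ l → + sum l) (map-cong (λ f → cong product (map-cong (λ { (b , ν) → refl }) f)) admissible) ⟩
    + CwFormula m j ∎)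
    where
    φ : Test
    φ i c = ind ((i ℕ.≟ j) ×-dec (c ≟ 0#))
    admissible : List (List (Carrier × ℕ))
    admissible = filter (λ f → (famSize f ℕ.≟ j) ×-dec (famWeightedSum f ≟ 0#)) (families m elements)

-- Tools for the moments: shifted ranges, superset counts and powers.

module RangeSums where
  open ℤΣ

  Σ-range : ∀ j h f → (∀ t → t < j → f t ≡ 0ℤ) → Σ (range j h) f ≡ Σ (upTo (suc h)) f
  Σ-range j h f = go j (suc h) f
    where
    go : ∀ j n f → (∀ t → t < j → f t ≡ 0ℤ) → Σ (map (j ℕ.+_) (upTo (n ∸ j))) f ≡ Σ (upTo n) f
    go zero    n       f e = Σ-map (upTo n) id f
    go (suc j) zero    f e = refl
    go (suc j) (suc n) f e = begin
      Σ (map (suc j ℕ.+_) (upTo (n ∸ j))) f        ≡⟨ Σ-map (upTo (n ∸ j)) _ f ⟩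
      Σ (upTo (n ∸ j)) (λ i → f (suc (j ℕ.+ i)))   ≡⟨ sym (Σ-map (upTo (n ∸ j)) (j ℕ.+_) (f ∘ suc)) ⟩
      Σ (map (j ℕ.+_) (upTo (n ∸ j))) (f ∘ suc)    ≡⟨ go j n (f ∘ suc) (λ t t<j → e (suc t) (s≤s t<j)) ⟩
      Σ (upTo n) (f ∘ suc)                         ≡⟨ sym (ℤₚ.+-identityˡ _) ⟩
      0ℤ ℤ.+ Σ (upTo n) (f ∘ suc)                  ≡⟨ cong (ℤ._+ Σ (upTo n) (f ∘ suc)) (sym (e 0 (s≤s z≤n))) ⟩
      f 0 ℤ.+ Σ (upTo n) (f ∘ suc)                 ≡⟨ sym (Σ-upTo-suc n f) ⟩
      Σ (upTo (suc n)) f                           ∎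
      where open ≡-Reasoning

-- superChoose N t j = C(N − j, t − j), counting the t-subsets that contain a
-- given j-subset; it is 0 when t < j.
superChoose : ℕ → ℕ → ℕ → ℕ
superChoose N       t       zero    = N C t
superChoose N       zero    (suc j) = 0
superChoose zero    (suc t) (suc j) = 0
superChoose (suc N) (suc t) (suc j) = superChoose N t j

-- Pascal's rule after the j forced elements are removed. The bound matters: for j = N + 1 and t = N
-- the left side is 1 and the right side 0.
superChoose-pascal : ∀ {N} t {j} → j ≤ N →
  superChoose (suc N) (suc t) j ≡ superChoose N (suc t) j ℕ.+ superChoose N t j
superChoose-pascal {N} t {zero} _ = trans (sym (nCk+nC[k+1]≡[n+1]C[k+1] N t)) (ℕₚ.+-comm (N C t) (N C suc t))
superChoose-pascal zero    {suc zero}    (s≤s j≤N) = refl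
superChoose-pascal zero    {suc (suc j)} (s≤s j≤N) = refl
superChoose-pascal (suc t) {suc j}       (s≤s j≤N) = superChoose-pascal t j≤N

superChoose-zero : ∀ N j → superChoose (suc N) 0 j ≡ superChoose N 0 j
superChoose-zero N zero    = refl
superChoose-zero N (suc j) = refl

superChoose-vanishes : ∀ N {t j} → t < j → superChoose N t j ≡ 0
superChoose-vanishes N       {zero}  {suc j} _         = refl
superChoose-vanishes zero    {suc t} {suc j} _         = refl
superChoose-vanishes (suc N) {suc t} {suc j} (s≤s t<j) = superChoose-vanishes N t<j

-- The symmetry C(N - j, t - j) = C(N - j, N - t). For t > N the lower index on the right is
-- negative, where `binomZ` is 0, in agreement with the left.
superChoose≡binomZ : ∀ N t j → j ≤ N → j ≤ t → superChoose N t j ≡ binomZ (N ∸ j) (ℤ.+ N ℤ.- ℤ.+ t)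
superChoose≡binomZ N t zero _ _ with t ℕ.≤? N
... | yes t≤N = trans (nCk≡nC[n∸k] t≤N) (cong (binomZ N) (sym (trans (ℤₚ.m-n≡m⊖n N t) (ℤₚ.⊖-≥ t≤N))))
... | no t≰N  = trans (k>n⇒nCk≡0 (ℕₚ.≰⇒> t≰N)) (sym (trans (cong (binomZ N) (trans (ℤₚ.m-n≡m⊖n N t) (ℤₚ.⊖-< (ℕₚ.≰⇒> t≰N))))
                  (negative (t ∸ N) (ℕₚ.m<n⇒0<n∸m (ℕₚ.≰⇒> t≰N)))))
  where
  negative : ∀ d → 0 < d → binomZ N (ℤ.- ℤ.+ d) ≡ 0
  negative (suc d) _ = refl
superChoose≡binomZ (suc N) (suc t) (suc j) (s≤s j≤N) (s≤s j≤t) = trans (superChoose≡binomZ N t j j≤N j≤t)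
  (cong (binomZ (N ∸ j)) (trans (ℤₚ.m-n≡m⊖n N t) (trans (sym (ℤₚ.[1+m]⊖[1+n]≡m⊖n N t)) (sym (ℤₚ.m-n≡m⊖n (suc N) (suc t))))))

pos-^ : ∀ a n → ℤ.+ (a ℕ.^ n) ≡ (ℤ.+ a) ℤ.^ n
pos-^ a zero    = refl
pos-^ a (suc n) = trans (ℤₚ.pos-* a (a ℕ.^ n)) (cong (ℤ.+ a ℤ.*_) (pos-^ a n))

^-distribʳ-* : ∀ x y n → (x ℤ.* y) ℤ.^ n ≡ x ℤ.^ n ℤ.* y ℤ.^ n
^-distribʳ-* x y zero    = refl
^-distribʳ-* x y (suc n) = trans (cong ((x ℤ.* y) ℤ.*_) (^-distribʳ-* x y n)) (lemma x y (x ℤ.^ n) (y ℤ.^ n))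
  where
  lemma : ∀ x y p q → (x ℤ.* y) ℤ.* (p ℤ.* q) ≡ (x ℤ.* p) ℤ.* (y ℤ.* q)
  lemma = solve-∀

-- The Pless identity and the power moments.

module Moments (F : FiniteField) (r k : ℕ) (r≡1+k : r ≡ suc k)
               (card : length (FiniteField.elements F) ≡ 2 ℕ.^ r) where
  open FiniteField F
  open FF F
  open FieldTheory F
  open CharacterSums F r k r≡1+k card
  open WeightDistribution F
  open ℤΣ
  open IntegerSums
  open BinomialSums
  open RangeSums
  open import Data.Integer using (+_)
  open ≡-Reasoning

  -- The trace of y as a natural number, read off from the sign: ψ y = 1 - 2 · `bit y`.
  bit : Carrier → ℕ
  bit y with ψ-±1 y
  ... | inj₁ _ = 0
  ... | inj₂ _ = 1

  bit-spec : ∀ y → ψ y ℤ.+ + 2 ℤ.* + bit y ≡ 1ℤ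
  bit-spec y with ψ-±1 y
  ... | inj₁ e rewrite e = refl
  ... | inj₂ e rewrite e = refl

  -- the weight of the dual codeword (tr(x v₁), tr(x v₂), …)
  dualWeight : Carrier → ∀ {N} → Vec Carrier N → ℕ
  dualWeight x []      = 0
  dualWeight x (y ∷ v) = bit (x * y) ℕ.+ dualWeight x v

  bit-C : ∀ y w t → + ((bit y ℕ.+ w) C suc t) ≡ + (w C suc t) ℤ.+ + bit y ℤ.* + (w C t)
  bit-C y w t with ψ-±1 y
  ... | inj₁ _ = sym (trans (cong (λ z → + (w C suc t) ℤ.+ z) (ℤₚ.*-zeroˡ (+ (w C t)))) (ℤₚ.+-identityʳ _))
  ... | inj₂ _ = trans (cong +_ (trans (sym (nCk+nC[k+1]≡[n+1]C[k+1] w t)) (ℕₚ.+-comm (w C t) (w C suc t))))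
                       (trans (ℤₚ.pos-+ (w C suc t) (w C t)) (cong (λ z → + (w C suc t) ℤ.+ z) (sym (ℤₚ.*-identityˡ (+ (w C t))))))

  weight≤ : ∀ {N} (u : Vec _ N) → weight u ≤ N
  weight≤ []          = z≤n
  weight≤ (true ∷ u)  = s≤s (weight≤ u)
  weight≤ (false ∷ u) = ℕₚ.m≤n⇒m≤1+n (weight≤ u)

  signedSum : Carrier → ∀ {N} → Vec Carrier N → ℕ → ℤ
  signedSum x {N} v t =
    Σ (boolVecs N) (λ u → (sgn (weight u) ℤ.* ψ (x * dot u v)) ℤ.* + superChoose N t (weight u))

  -- Expand 2^t C(w, t) = Σ_T ∏_{i ∈ T} (1 − ψ(x vᵢ)) over t-subsets T and collect the
  -- terms by the subset u ⊆ T on which the factor −ψ is chosen.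
  signedSum-binomial : ∀ x {N} (v : Vec Carrier N) t → + (2 ℕ.^ t) ℤ.* + (dualWeight x v C t) ≡ signedSum x v t
  signedSum-binomial x [] t = trans (base t) (sym (trans (Σ-singleton [])
    (cong (λ z → (1ℤ ℤ.* z) ℤ.* + (0 C t)) (trans (cong ψ (zeroʳ x)) ψ-0))))
    where
    base : ∀ t → + (2 ℕ.^ t) ℤ.* + (0 C t) ≡ 1ℤ ℤ.* + (0 C t)
    base zero    = refl
    base (suc t) = trans (ℤₚ.*-zeroʳ (+ (2 ℕ.^ suc t))) (sym (ℤₚ.*-zeroʳ 1ℤ))
  signedSum-binomial x {suc N} (y ∷ v) zero = begin
    1ℤ
      ≡⟨ signedSum-binomial x v 0 ⟩
    signedSum x v 0
      ≡⟨ Σ-cong (boolVecs N) (λ u → cong (λ z → (sgn (weight u) ℤ.* ψ (x * dot u v)) ℤ.* + z) (sym (superChoose-zero N (weight u)))) ⟩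
    Σ (boolVecs N) (λ u → (sgn (weight u) ℤ.* ψ (x * dot u v)) ℤ.* + superChoose (suc N) 0 (weight u))
      ≡⟨ sym (ℤₚ.+-identityˡ _) ⟩
    0ℤ ℤ.+ Σ (boolVecs N) (λ u → (sgn (weight u) ℤ.* ψ (x * dot u v)) ℤ.* + superChoose (suc N) 0 (weight u))
      ≡⟨ cong (ℤ._+ Σ (boolVecs N) (λ u → (sgn (weight u) ℤ.* ψ (x * dot u v)) ℤ.* + superChoose (suc N) 0 (weight u)))
           (sym (Σ-0 (boolVecs N) (λ {u} _ → ℤₚ.*-zeroʳ (sgn (suc (weight u)) ℤ.* ψ (x * (y + dot u v)))))) ⟩
    Σ (boolVecs N) (λ u → (sgn (suc (weight u)) ℤ.* ψ (x * (y + dot u v))) ℤ.* 0ℤ)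
      ℤ.+ Σ (boolVecs N) (λ u → (sgn (weight u) ℤ.* ψ (x * dot u v)) ℤ.* + superChoose (suc N) 0 (weight u))
      ≡⟨ sym (Σ-boolVecs-suc N _) ⟩
    signedSum x (y ∷ v) 0 ∎
  signedSum-binomial x {suc N} (y ∷ v) (suc t) = begin
    + (2 ℕ.^ suc t) ℤ.* + ((bit (x * y) ℕ.+ w) C suc t)
      ≡⟨ cong₂ ℤ._*_ (ℤₚ.pos-* 2 (2 ℕ.^ t)) (bit-C (x * y) w t) ⟩
    (+ 2 ℤ.* + (2 ℕ.^ t)) ℤ.* (+ (w C suc t) ℤ.+ + bit (x * y) ℤ.* + (w C t))
      ≡⟨ arrange (+ (2 ℕ.^ t)) (+ (w C suc t)) (+ bit (x * y)) (+ (w C t)) (ψ (x * y)) ⟩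
    ((+ 2 ℤ.* + (2 ℕ.^ t)) ℤ.* + (w C suc t))
      ℤ.+ ((ψ (x * y) ℤ.+ + 2 ℤ.* + bit (x * y)) ℤ.- ψ (x * y)) ℤ.* (+ (2 ℕ.^ t) ℤ.* + (w C t))
      ≡⟨ cong₂ (λ a b → a ℤ.* + (w C suc t) ℤ.+ (b ℤ.- ψ (x * y)) ℤ.* (+ (2 ℕ.^ t) ℤ.* + (w C t)))
           (sym (ℤₚ.pos-* 2 (2 ℕ.^ t))) (bit-spec (x * y)) ⟩
    (+ (2 ℕ.^ suc t) ℤ.* + (w C suc t)) ℤ.+ (1ℤ ℤ.- ψ (x * y)) ℤ.* (+ (2 ℕ.^ t) ℤ.* + (w C t))
      -- Subsets T without the position of y give the first term. Those with it carry the extra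
      -- factor 1 - ψ(xy), which is 2 or 0 according to the bit.
      ≡⟨ cong₂ (λ a b → a ℤ.+ (1ℤ ℤ.- ψ (x * y)) ℤ.* b) (signedSum-binomial x v (suc t)) (signedSum-binomial x v t) ⟩
    signedSum x v (suc t) ℤ.+ (1ℤ ℤ.- ψ (x * y)) ℤ.* signedSum x v t
      ≡⟨ collect (signedSum x v (suc t)) (ψ (x * y)) (signedSum x v t) ⟩
    (-1ℤ ℤ.* ψ (x * y)) ℤ.* signedSum x v t ℤ.+ (signedSum x v (suc t) ℤ.+ signedSum x v t)
      ≡⟨ cong₂ ℤ._+_ (sym (Σ-*ˡ (boolVecs N) (-1ℤ ℤ.* ψ (x * y)) _)) (sym (Σ-+ (boolVecs N) _ _)) ⟩
    Σ (boolVecs N) (λ u → (-1ℤ ℤ.* ψ (x * y)) ℤ.* (a u ℤ.* + superChoose N t (weight u)))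
      ℤ.+ Σ (boolVecs N) (λ u → a u ℤ.* + superChoose N (suc t) (weight u) ℤ.+ a u ℤ.* + superChoose N t (weight u))
      -- If u contains the new position, so must T. If not, T may contain or avoid it, and
      -- `superChoose-pascal` merges these two cases.
      ≡⟨ cong₂ ℤ._+_ (Σ-cong (boolVecs N) taken) (Σ-cong (boolVecs N) skipped) ⟩
    Σ (boolVecs N) (λ u → (sgn (suc (weight u)) ℤ.* ψ (x * (y + dot u v))) ℤ.* + superChoose N t (weight u))
      ℤ.+ Σ (boolVecs N) (λ u → a u ℤ.* + superChoose (suc N) (suc t) (weight u))
      ≡⟨ sym (Σ-boolVecs-suc N _) ⟩
    signedSum x (y ∷ v) (suc t) ∎
    where
    w = dualWeight x v
    a : Vec _ N → ℤ
    a u = sgn (weight u) ℤ.* ψ (x * dot u v)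
    arrange : ∀ p c b d e → (+ 2 ℤ.* p) ℤ.* (c ℤ.+ b ℤ.* d)
      ≡ ((+ 2 ℤ.* p) ℤ.* c) ℤ.+ ((e ℤ.+ + 2 ℤ.* b) ℤ.- e) ℤ.* (p ℤ.* d)
    arrange = solve-∀
    collect : ∀ s p z → s ℤ.+ (1ℤ ℤ.- p) ℤ.* z ≡ (-1ℤ ℤ.* p) ℤ.* z ℤ.+ (s ℤ.+ z)
    collect = solve-∀
    regroup : ∀ p s z c → (-1ℤ ℤ.* p) ℤ.* ((s ℤ.* z) ℤ.* c) ≡ ((-1ℤ ℤ.* s) ℤ.* (p ℤ.* z)) ℤ.* c
    regroup = solve-∀
    taken : ∀ u → (-1ℤ ℤ.* ψ (x * y)) ℤ.* (a u ℤ.* + superChoose N t (weight u))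
      ≡ (sgn (suc (weight u)) ℤ.* ψ (x * (y + dot u v))) ℤ.* + superChoose N t (weight u)
    taken u = trans (regroup (ψ (x * y)) (sgn (weight u)) (ψ (x * dot u v)) (+ superChoose N t (weight u)))
      (cong (λ z → (sgn (suc (weight u)) ℤ.* z) ℤ.* + superChoose N t (weight u))
        (trans (sym (ψ-+ (x * y) (x * dot u v))) (cong ψ (sym (distribˡ x y (dot u v))))))
    skipped : ∀ u → a u ℤ.* + superChoose N (suc t) (weight u) ℤ.+ a u ℤ.* + superChoose N t (weight u)
      ≡ a u ℤ.* + superChoose (suc N) (suc t) (weight u)
    skipped u = trans (sym (ℤₚ.*-distribˡ-+ (a u) _ _)) (cong (a u ℤ.*_)
      (trans (sym (ℤₚ.pos-+ (superChoose N (suc t) (weight u)) _)) (cong +_ (sym (superChoose-pascal t (weight≤ u))))))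

  double-dualWeight : ∀ x L →
    + 2 ℤ.* + dualWeight x (fromList L) ≡ + length L ℤ.+ -1ℤ ℤ.* Σ L (λ y → ψ (x * y))
  double-dualWeight x []      = sym (cong (λ z → 0ℤ ℤ.+ -1ℤ ℤ.* z) Σ-[])
  double-dualWeight x (y ∷ L) = begin
    + 2 ℤ.* + (bit (x * y) ℕ.+ w)
      ≡⟨ cong (+ 2 ℤ.*_) (ℤₚ.pos-+ (bit (x * y)) w) ⟩
    + 2 ℤ.* (+ bit (x * y) ℤ.+ + w)
      ≡⟨ arrange (+ bit (x * y)) (+ w) (ψ (x * y)) ⟩
    (ψ (x * y) ℤ.+ + 2 ℤ.* + bit (x * y)) ℤ.+ + 2 ℤ.* + w ℤ.+ -1ℤ ℤ.* ψ (x * y)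
      ≡⟨ cong₂ (λ a b → a ℤ.+ b ℤ.+ -1ℤ ℤ.* ψ (x * y)) (bit-spec (x * y)) (double-dualWeight x L) ⟩
    1ℤ ℤ.+ (+ length L ℤ.+ -1ℤ ℤ.* Σ L (λ y → ψ (x * y))) ℤ.+ -1ℤ ℤ.* ψ (x * y)
      ≡⟨ collect (+ length L) (Σ L (λ y → ψ (x * y))) (ψ (x * y)) ⟩
    (1ℤ ℤ.+ + length L) ℤ.+ -1ℤ ℤ.* (ψ (x * y) ℤ.+ Σ L (λ y → ψ (x * y)))
      ≡⟨ cong (λ z → (1ℤ ℤ.+ + length L) ℤ.+ -1ℤ ℤ.* z) (sym (Σ-∷ y L)) ⟩
    + length (y ∷ L) ℤ.+ -1ℤ ℤ.* Σ (y ∷ L) (λ y → ψ (x * y)) ∎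
    where
    w = dualWeight x (fromList L)
    arrange : ∀ b w p → + 2 ℤ.* (b ℤ.+ w) ≡ (p ℤ.+ + 2 ℤ.* b) ℤ.+ + 2 ℤ.* w ℤ.+ -1ℤ ℤ.* p
    arrange = solve-∀
    collect : ∀ n s p → 1ℤ ℤ.+ (n ℤ.+ -1ℤ ℤ.* s) ℤ.+ -1ℤ ℤ.* p ≡ (1ℤ ℤ.+ n) ℤ.+ -1ℤ ℤ.* (p ℤ.+ s)
    collect = solve-∀

  -- The contribution of a word of weight j to (2w)^h, up to its sign and character value. The
  -- difference stands for t! S(h, t); of the factor 2^h, the part 2^t has been spent in
  -- `signedSum-binomial`.
  plessCoefficient : ℕ → ℕ → ℕ → ℤ
  plessCoefficient N h j = Σ (upTo (suc h)) (λ t → (Δ t (power h) ℤ.* + (2 ℕ.^ (h ∸ t))) ℤ.* + superChoose N t j)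

  plessCoefficient-vanishes : ∀ N h {j} → h < j → plessCoefficient N h j ≡ 0ℤ
  plessCoefficient-vanishes N h {j} h<j = Σ-0 (upTo (suc h)) (λ {t} t∈ → trans
    (cong (λ z → (Δ t (power h) ℤ.* + (2 ℕ.^ (h ∸ t))) ℤ.* + z) (superChoose-vanishes N (ℕₚ.<-≤-trans (∈-upTo⁻ t∈) h<j)))
    (ℤₚ.*-zeroʳ (Δ t (power h) ℤ.* + (2 ℕ.^ (h ∸ t)))))

  power-dualWeight : ∀ h x {N} (v : Vec Carrier N) →
    (+ 2 ℤ.* + dualWeight x v) ℤ.^ h
      ≡ Σ (boolVecs N) (λ u → (sgn (weight u) ℤ.* ψ (x * dot u v)) ℤ.* plessCoefficient N h (weight u))
  power-dualWeight h x {N} v = begin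
    (+ 2 ℤ.* + w) ℤ.^ h
      ≡⟨ trans (^-distribʳ-* (+ 2) (+ w) h) (sym (cong₂ ℤ._*_ (pos-^ 2 h) (pos-^ w h))) ⟩
    + (2 ℕ.^ h) ℤ.* power h w
      ≡⟨ cong (+ (2 ℕ.^ h) ℤ.*_) (power-newton h w) ⟩
    + (2 ℕ.^ h) ℤ.* Σ T (λ t → Δ t (power h) ℤ.* + (w C t))
      ≡⟨ sym (Σ-*ˡ T (+ (2 ℕ.^ h)) _) ⟩
    Σ T (λ t → + (2 ℕ.^ h) ℤ.* (Δ t (power h) ℤ.* + (w C t)))
      ≡⟨ Σ-cong∈ T (λ {t} t∈ → trans
           (cong (ℤ._* (Δ t (power h) ℤ.* + (w C t))) (split-power (ℕₚ.≤-pred (∈-upTo⁻ t∈))))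
           (trans (arrange (+ (2 ℕ.^ (h ∸ t))) (+ (2 ℕ.^ t)) (Δ t (power h)) (+ (w C t)))
             (cong ((Δ t (power h) ℤ.* + (2 ℕ.^ (h ∸ t))) ℤ.*_) (signedSum-binomial x v t)))) ⟩
    Σ T (λ t → (Δ t (power h) ℤ.* + (2 ℕ.^ (h ∸ t))) ℤ.* signedSum x v t)
      ≡⟨ Σ-cong T (λ t → sym (Σ-*ˡ (boolVecs N) (Δ t (power h) ℤ.* + (2 ℕ.^ (h ∸ t))) _)) ⟩
    Σ T (λ t → Σ (boolVecs N) (λ u → (Δ t (power h) ℤ.* + (2 ℕ.^ (h ∸ t))) ℤ.* (a u ℤ.* + superChoose N t (weight u))))
      ≡⟨ Σ-swap T (boolVecs N) _ ⟩
    Σ (boolVecs N) (λ u → Σ T (λ t → (Δ t (power h) ℤ.* + (2 ℕ.^ (h ∸ t))) ℤ.* (a u ℤ.* + superChoose N t (weight u))))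
      ≡⟨ Σ-cong (boolVecs N) (λ u → trans
           (Σ-cong T (λ t → exchange (Δ t (power h) ℤ.* + (2 ℕ.^ (h ∸ t))) (a u) (+ superChoose N t (weight u))))
           (Σ-*ˡ T (a u) _)) ⟩
    Σ (boolVecs N) (λ u → a u ℤ.* plessCoefficient N h (weight u)) ∎
    where
    w = dualWeight x v
    T = upTo (suc h)
    a : Vec _ N → ℤ
    a u = sgn (weight u) ℤ.* ψ (x * dot u v)
    split-power : ∀ {t} → t ≤ h → + (2 ℕ.^ h) ≡ + (2 ℕ.^ (h ∸ t)) ℤ.* + (2 ℕ.^ t)
    split-power {t} t≤h = trans (cong (λ n → + (2 ℕ.^ n)) (sym (ℕₚ.m∸n+n≡m t≤h)))
      (trans (cong +_ (ℕₚ.^-distribˡ-+-* 2 (h ∸ t) t)) (ℤₚ.pos-* (2 ℕ.^ (h ∸ t)) (2 ℕ.^ t)))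
    arrange : ∀ p q d c → (p ℤ.* q) ℤ.* (d ℤ.* c) ≡ (d ℤ.* p) ℤ.* (q ℤ.* c)
    arrange = solve-∀
    exchange : ∀ d a c → d ℤ.* (a ℤ.* c) ≡ a ℤ.* (d ℤ.* c)
    exchange = solve-∀

  module _ (m : ℕ) where

    N : ℕ
    N = length (gs m)

    word : Vec Carrier N
    word = fromList (gs m)

    -- Codewords are sorted by weight. The range may stop at the minimum of N and h, since no word
    -- of length N is heavier than N and `G` vanishes beyond h.
    Σ-by-weight : ∀ h (G : ℕ → ℤ) → (∀ j → h < j → G j ≡ 0ℤ) →
      Σ (boolVecs N) (λ u → ind (dot u word ≟ 0#) ℤ.* G (weight u)) ≡ Σ (upTo (suc (N ⊓ h))) (λ j → + Cw m j ℤ.* G j)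
    Σ-by-weight h G vanish = sym (begin
      Σ J (λ j → + Cw m j ℤ.* G j)
        ≡⟨ Σ-cong J (λ j → trans (cong (ℤ._* G j) (Cw-wordSum m j)) (sym (Σ-*ʳ (boolVecs N) (G j) _))) ⟩
      Σ J (λ j → Σ (boolVecs N) (λ u → ind ((weight u ℕ.≟ j) ×-dec (dot u word ≟ 0#)) ℤ.* G j))
        ≡⟨ Σ-swap J (boolVecs N) _ ⟩
      Σ (boolVecs N) (λ u → Σ J (λ j → ind ((weight u ℕ.≟ j) ×-dec (dot u word ≟ 0#)) ℤ.* G j))
        ≡⟨ Σ-cong (boolVecs N) (λ u → pick (weight≤ u) (dot u word ≟ 0#)) ⟩
      Σ (boolVecs N) (λ u → ind (dot u word ≟ 0#) ℤ.* G (weight u)) ∎)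
      where
      J = upTo (suc (N ⊓ h))
      off : ∀ {P : Set} i (d : Dec P) j → j ≢ i → ind ((i ℕ.≟ j) ×-dec d) ℤ.* G j ≡ 0ℤ
      off i d j j≢i = trans (cong (ℤ._* G j) (ind-no ((i ℕ.≟ j) ×-dec d) (λ p → j≢i (sym (proj₁ p))))) (ℤₚ.*-zeroˡ (G j))
      pick : ∀ {P : Set} {i} → i ≤ N → (d : Dec P) → Σ J (λ j → ind ((i ℕ.≟ j) ×-dec d) ℤ.* G j) ≡ ind d ℤ.* G i
      pick {i = i} i≤N d with i ℕ.≤? h
      ... | yes i≤h = trans
        (Σ-single _ (Unique.upTo⁺ (suc (N ⊓ h))) (∈-upTo⁺ (s≤s (ℕₚ.⊓-glb i≤N i≤h))) (λ {j} _ → off i d j))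
        (cong (ℤ._* G i) (ind-cong ((i ℕ.≟ i) ×-dec d) d proj₂ (refl ,_)))
      ... | no i≰h = trans
        (Σ-0 J (λ {j} j∈ → off i d j (λ { refl → i≰h (ℕₚ.≤-trans (ℕₚ.≤-pred (∈-upTo⁻ j∈)) (ℕₚ.m⊓n≤n N h)) })))
        (sym (trans (cong (ind d ℤ.*_) (vanish i (ℕₚ.≰⇒> i≰h))) (ℤₚ.*-zeroʳ (ind d))))

    -- In the expansion of `power-dualWeight` only the character value depends on x. Summing it over
    -- F gives q for words of syndrome 0 and kills all others.
    pless : ∀ h → Σ elements (λ x → (+ 2 ℤ.* + dualWeight x word) ℤ.^ h)
      ≡ + q ℤ.* Σ (upTo (suc (N ⊓ h))) (λ j → + Cw m j ℤ.* (sgn j ℤ.* plessCoefficient N h j))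
    pless h = begin
      Σ elements (λ x → (+ 2 ℤ.* + dualWeight x word) ℤ.^ h)
        ≡⟨ Σ-cong elements (λ x → power-dualWeight h x word) ⟩
      Σ elements (λ x → Σ (boolVecs N) (λ u → (sgn (weight u) ℤ.* ψ (x * dot u word)) ℤ.* H (weight u)))
        ≡⟨ Σ-swap elements (boolVecs N) _ ⟩
      Σ (boolVecs N) (λ u → Σ elements (λ x → (sgn (weight u) ℤ.* ψ (x * dot u word)) ℤ.* H (weight u)))
        ≡⟨ Σ-cong (boolVecs N) (λ u → trans (Σ-*ʳ elements (H (weight u)) _)
             (trans (cong (ℤ._* H (weight u)) (trans (Σ-*ˡ elements (sgn (weight u)) _) (cong (sgn (weight u) ℤ.*_) (Σψ-scaled (dot u word)))))
               (arrange (sgn (weight u)) (+ q) (ind (dot u word ≟ 0#)) (H (weight u))))) ⟩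
      Σ (boolVecs N) (λ u → + q ℤ.* (ind (dot u word ≟ 0#) ℤ.* (sgn (weight u) ℤ.* H (weight u))))
        ≡⟨ Σ-*ˡ (boolVecs N) (+ q) _ ⟩
      + q ℤ.* Σ (boolVecs N) (λ u → ind (dot u word ≟ 0#) ℤ.* (sgn (weight u) ℤ.* H (weight u)))
        ≡⟨ cong (+ q ℤ.*_) (Σ-by-weight h (λ j → sgn j ℤ.* H j)
             (λ j h<j → trans (cong (sgn j ℤ.*_) (plessCoefficient-vanishes N h h<j)) (ℤₚ.*-zeroʳ (sgn j)))) ⟩
      + q ℤ.* Σ (upTo (suc (N ⊓ h))) (λ j → + Cw m j ℤ.* (sgn j ℤ.* H j)) ∎
      where
      H = plessCoefficient N h
      arrange : ∀ s q i h → (s ℤ.* (q ℤ.* i)) ℤ.* h ≡ q ℤ.* (i ℤ.* (s ℤ.* h))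
      arrange = solve-∀

    N≡ : N ≡ (q ∸ 1) ℕ.^ m
    N≡ = trans (length-map g (tuples m)) (length-tuples m)

    MK-Σ : ∀ l → MK r m l ≡ Σ nonzeros (λ x → K r m x ℤ.^ l)
    MK-Σ l = sym (Σ-def nonzeros _)

    -- For x ≠ 0 twice the weight is N - K_m(x), which is expanded binomially. For x = 0 the word is
    -- zero and contributes 0^h, which is 0 because h ≥ 1.
    dualWeight-moments : ∀ s → suc m ≡ 2 ℕ.^ s → ∀ h → 1 ≤ h →
      Σ elements (λ x → (+ 2 ℤ.* + dualWeight x word) ℤ.^ h)
        ≡ Σ (upTo (suc h)) (λ l → + (h C l) ℤ.* ((+ N) ℤ.^ (h ∸ l) ℤ.* (sgn l ℤ.* MK r m l)))
    dualWeight-moments s e h 1≤h = begin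
      Σ elements W
        ≡⟨ Σ-elements-split W ⟩
      W 0# ℤ.+ Σ nonzeros W
        ≡⟨ cong (ℤ._+ Σ nonzeros W) (trans (cong (ℤ._^ h) (at-zero)) (0^ h 1≤h)) ⟩
      0ℤ ℤ.+ Σ nonzeros W
        ≡⟨ ℤₚ.+-identityˡ _ ⟩
      Σ nonzeros W
        ≡⟨ Σ-cong∈ nonzeros (λ {x} x∈ → trans (cong (ℤ._^ h) (off-zero (∈nonzeros x∈))) (binomial-theorem h (+ N) (-1ℤ ℤ.* K r m x))) ⟩
      Σ nonzeros (λ x → Σ L (λ l → + (h C l) ℤ.* ((+ N) ℤ.^ (h ∸ l) ℤ.* (-1ℤ ℤ.* K r m x) ℤ.^ l)))
        ≡⟨ Σ-swap nonzeros L _ ⟩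
      Σ L (λ l → Σ nonzeros (λ x → + (h C l) ℤ.* ((+ N) ℤ.^ (h ∸ l) ℤ.* (-1ℤ ℤ.* K r m x) ℤ.^ l)))
        ≡⟨ Σ-cong L (λ l → trans (Σ-*ˡ nonzeros (+ (h C l)) _) (cong (+ (h C l) ℤ.*_)
             (trans (Σ-*ˡ nonzeros ((+ N) ℤ.^ (h ∸ l)) _) (cong ((+ N) ℤ.^ (h ∸ l) ℤ.*_)
               (trans (Σ-cong nonzeros (λ x → ^-distribʳ-* -1ℤ (K r m x) l))
                 (trans (Σ-*ˡ nonzeros (sgn l) _) (cong (sgn l ℤ.*_) (sym (MK-Σ l))))))))) ⟩
      Σ L (λ l → + (h C l) ℤ.* ((+ N) ℤ.^ (h ∸ l) ℤ.* (sgn l ℤ.* MK r m l))) ∎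
      where
      L = upTo (suc h)
      W : Carrier → ℤ
      W x = (+ 2 ℤ.* + dualWeight x word) ℤ.^ h
      0^ : ∀ h → 1 ≤ h → 0ℤ ℤ.^ h ≡ 0ℤ
      0^ (suc h) _ = ℤₚ.*-zeroˡ (0ℤ ℤ.^ h)
      at-zero : + 2 ℤ.* + dualWeight 0# word ≡ 0ℤ
      at-zero = trans (double-dualWeight 0# (gs m)) (trans
        (cong (λ z → + N ℤ.+ -1ℤ ℤ.* z) (trans (Σ-cong (gs m) (λ y → trans (cong ψ (zeroˡ y)) ψ-0)) (Σ-const (gs m) 1ℤ)))
        (cancel (+ N)))
        where
        cancel : ∀ n → n ℤ.+ -1ℤ ℤ.* (n ℤ.* 1ℤ) ≡ 0ℤ
        cancel = solve-∀
      off-zero : ∀ {x} → x ≢ 0# → + 2 ℤ.* + dualWeight x word ≡ + N ℤ.+ -1ℤ ℤ.* K r m x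
      off-zero {x} x≢0 = trans (double-dualWeight x (gs m))
        (cong (λ z → + N ℤ.+ -1ℤ ℤ.* z) (trans (Σ-map (tuples m) g (λ y → ψ (x * y))) (Σψ-scaled-g m s e x≢0)))

    plessCoefficient-stirling : ∀ h j → j ≤ N → plessCoefficient N h j
      ≡ Σ (range j h) (λ t → + (t !) ℤ.* S h t ℤ.* + (2 ℕ.^ (h ∸ t)) ℤ.* + binomZ (N ∸ j) (+ N ℤ.- + t))
    plessCoefficient-stirling h j j≤N = trans
      (sym (Σ-range j h _ (λ t t<j → trans
        (cong (λ z → (Δ t (power h) ℤ.* + (2 ℕ.^ (h ∸ t))) ℤ.* + z) (superChoose-vanishes N t<j)) (ℤₚ.*-zeroʳ (Δ t (power h) ℤ.* + (2 ℕ.^ (h ∸ t)))))))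
      (trans (Σ-map (upTo (suc h ∸ j)) (j ℕ.+_) _)
        (trans (Σ-cong (upTo (suc h ∸ j)) (λ i → cong₂ (λ a b → a ℤ.* + (2 ℕ.^ (h ∸ (j ℕ.+ i))) ℤ.* + b)
                 (sym (t!S≡Δ h (j ℕ.+ i))) (superChoose≡binomZ N (j ℕ.+ i) j j≤N (ℕₚ.m≤m+n j i))))
          (sym (Σ-map (upTo (suc h ∸ j)) (j ℕ.+_) _))))

    -- Equating `pless` with `dualWeight-moments` gives a relation whose term l = h is (-1)^h times
    -- the wanted moment; that term is isolated and the relation multiplied by (-1)^h.
    MK-recursion : ∀ s → suc m ≡ 2 ℕ.^ s → ∀ h → 1 ≤ h → MK r m h
      ≡ Σ (upTo h) (λ l → sgn (h ℕ.+ l ℕ.+ 1) ℤ.* + (h C l) ℤ.* + ((q ∸ 1) ℕ.^ (m ℕ.* (h ∸ l))) ℤ.* MK r m l)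
        ℤ.+ + q ℤ.* Σ (range 0 (N ⊓ h)) (λ j → sgn (h ℕ.+ j) ℤ.* + Cw m j ℤ.* plessCoefficient N h j)
    MK-recursion s e h 1≤h = begin
      MK r m h
        ≡⟨ solve-for (Σ (upTo h) A) (MK r m h) (sgn h) (sgn-square h) ⟩
      (-1ℤ ℤ.* sgn h) ℤ.* Σ (upTo h) A ℤ.+ sgn h ℤ.* (Σ (upTo h) A ℤ.+ sgn h ℤ.* MK r m h)
        ≡⟨ cong₂ ℤ._+_ (trans (sym (Σ-*ˡ (upTo h) (-1ℤ ℤ.* sgn h) A)) (Σ-cong (upTo h) lower)) (cong (sgn h ℤ.*_) total) ⟩
      Σ (upTo h) B ℤ.+ sgn h ℤ.* (+ q ℤ.* Σ (upTo (suc (N ⊓ h))) (λ j → + Cw m j ℤ.* (sgn j ℤ.* H j)))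
        ≡⟨ cong (λ z → Σ (upTo h) B ℤ.+ z) (trans (exchange (sgn h) (+ q) _) (cong (+ q ℤ.*_) (trans (sym (Σ-*ˡ (upTo (suc (N ⊓ h))) (sgn h) _))
             (trans (Σ-cong (upTo (suc (N ⊓ h))) upper) (cong (λ l → Σ l (λ j → sgn (h ℕ.+ j) ℤ.* + Cw m j ℤ.* H j)) (sym (range-0 (N ⊓ h)))))))) ⟩
      Σ (upTo h) B ℤ.+ + q ℤ.* Σ (range 0 (N ⊓ h)) (λ j → sgn (h ℕ.+ j) ℤ.* + Cw m j ℤ.* H j) ∎
      where
      H = plessCoefficient N h
      A B : ℕ → ℤ
      A l = + (h C l) ℤ.* ((+ N) ℤ.^ (h ∸ l) ℤ.* (sgn l ℤ.* MK r m l))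
      B l = sgn (h ℕ.+ l ℕ.+ 1) ℤ.* + (h C l) ℤ.* + ((q ∸ 1) ℕ.^ (m ℕ.* (h ∸ l))) ℤ.* MK r m l
      solve-for : ∀ a k s → s ℤ.* s ≡ 1ℤ → k ≡ (-1ℤ ℤ.* s) ℤ.* a ℤ.+ s ℤ.* (a ℤ.+ s ℤ.* k)
      solve-for a k s e = trans (sym (ℤₚ.*-identityˡ k)) (trans (cong (ℤ._* k) (sym e)) (lemma a k s))
        where
        lemma : ∀ a k s → (s ℤ.* s) ℤ.* k ≡ (-1ℤ ℤ.* s) ℤ.* a ℤ.+ s ℤ.* (a ℤ.+ s ℤ.* k)
        lemma = solve-∀
      exchange : ∀ s q z → s ℤ.* (q ℤ.* z) ≡ q ℤ.* (s ℤ.* z)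
      exchange = solve-∀
      top : A h ≡ sgn h ℤ.* MK r m h
      top = trans (cong₂ (λ c e → + c ℤ.* ((+ N) ℤ.^ e ℤ.* (sgn h ℤ.* MK r m h))) (nCn≡1 h) (ℕₚ.n∸n≡0 h))
                  (trans (ℤₚ.*-identityˡ _) (ℤₚ.*-identityˡ _))
      total : Σ (upTo h) A ℤ.+ sgn h ℤ.* MK r m h ≡ + q ℤ.* Σ (upTo (suc (N ⊓ h))) (λ j → + Cw m j ℤ.* (sgn j ℤ.* H j))
      total = trans (cong (λ z → Σ (upTo h) A ℤ.+ z) (sym top))
        (trans (sym (Σ-upTo-last h A)) (trans (sym (dualWeight-moments s e h 1≤h)) (pless h)))
      N^ : ∀ i → (+ N) ℤ.^ i ≡ + ((q ∸ 1) ℕ.^ (m ℕ.* i))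
      N^ i = trans (sym (pos-^ N i)) (cong +_ (trans (cong (ℕ._^ i) N≡) (ℕₚ.^-*-assoc (q ∸ 1) m i)))
      sgn-h+l+1 : ∀ l → sgn (h ℕ.+ l ℕ.+ 1) ≡ (-1ℤ ℤ.* sgn h) ℤ.* sgn l
      sgn-h+l+1 l = trans (cong sgn (ℕₚ.+-comm (h ℕ.+ l) 1))
        (trans (cong (-1ℤ ℤ.*_) (sgn-+ h l)) (sym (ℤₚ.*-assoc -1ℤ (sgn h) (sgn l))))
      lower : ∀ l → (-1ℤ ℤ.* sgn h) ℤ.* A l ≡ B l
      lower l = trans (arrange (-1ℤ ℤ.* sgn h) (+ (h C l)) ((+ N) ℤ.^ (h ∸ l)) (sgn l) (MK r m l))
        (cong₂ (λ a b → a ℤ.* + (h C l) ℤ.* b ℤ.* MK r m l) (sym (sgn-h+l+1 l)) (N^ (h ∸ l)))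
        where
        arrange : ∀ s c n t k → s ℤ.* (c ℤ.* (n ℤ.* (t ℤ.* k))) ≡ (s ℤ.* t) ℤ.* c ℤ.* n ℤ.* k
        arrange = solve-∀
      upper : ∀ j → sgn h ℤ.* (+ Cw m j ℤ.* (sgn j ℤ.* H j)) ≡ sgn (h ℕ.+ j) ℤ.* + Cw m j ℤ.* H j
      upper j = trans (arrange (sgn h) (+ Cw m j) (sgn j) (H j)) (cong (λ z → z ℤ.* + Cw m j ℤ.* H j) (sym (sgn-+ h j)))
        where
        arrange : ∀ s c t k → s ℤ.* (c ℤ.* (t ℤ.* k)) ≡ (s ℤ.* t) ℤ.* c ℤ.* k
        arrange = solve-∀

  MK≡mkRHS : ∀ s h → 1 ≤ h → MK r (2 ℕ.^ s ∸ 1) h ≡ mkRHS r s h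
  MK≡mkRHS s h 1≤h = begin
    MK r m h
      ≡⟨ MK-recursion m s (ℕₚ.suc-pred (2 ℕ.^ s) {{ℕₚ.m^n≢0 2 s}}) h 1≤h ⟩
    Σ (upTo h) (λ l → sgn (h ℕ.+ l ℕ.+ 1) ℤ.* + (h C l) ℤ.* + ((q ∸ 1) ℕ.^ (m ℕ.* (h ∸ l))) ℤ.* MK r m l)
      ℤ.+ + q ℤ.* Σ (range 0 (N m ⊓ h)) (λ j → sgn (h ℕ.+ j) ℤ.* + Cw m j ℤ.* plessCoefficient (N m) h j)
      ≡⟨ cong₂ (λ a b → a ℤ.+ + q ℤ.* b) (Σ-def (upTo h) _)
           (trans (Σ-cong∈ (range 0 (N m ⊓ h)) (λ {j} j∈ → cong (sgn (h ℕ.+ j) ℤ.* + Cw m j ℤ.*_)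
              (trans (plessCoefficient-stirling m h j (in-range j∈)) (Σ-def (range j h) _))))
           (Σ-def (range 0 (N m ⊓ h)) _)) ⟩
    rhs (N m)
      -- The word has length `N m` by construction, so the bounds and binomials receive the closed
      -- form (q - 1)^m only at this point.
      ≡⟨ cong rhs (N≡ m) ⟩
    mkRHS r s h ∎
    where
    m = 2 ℕ.^ s ∸ 1
    in-range : ∀ {j} → j ∈ range 0 (N m ⊓ h) → j ≤ N m
    in-range {j} j∈ = ℕₚ.≤-trans (ℕₚ.≤-pred (∈-upTo⁻ (subst (j ∈_) (range-0 (N m ⊓ h)) j∈))) (ℕₚ.m⊓n≤m (N m) h)
    rhs : ℕ → ℤ
    rhs N = sumℤ (map (λ l → sgn (h ℕ.+ l ℕ.+ 1) ℤ.* + (h C l) ℤ.* + ((q ∸ 1) ℕ.^ (m ℕ.* (h ∸ l))) ℤ.* MK r m l) (upTo h))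
      ℤ.+ + q ℤ.* sumℤ (map (λ j → sgn (h ℕ.+ j) ℤ.* + Cw m j ℤ.*
            sumℤ (map (λ t → + (t !) ℤ.* S h t ℤ.* + (2 ℕ.^ (h ∸ t)) ℤ.* + binomZ (N ∸ j) (+ N ℤ.- + t)) (range j h)))
          (range 0 (N ⊓ h)))

open import Data.Nat using (ℕ; _≤_; _^_; _∸_; _*_; _+_)
open import Data.Integer using (ℤ; +_) renaming (_*_ to _*ℤ_; _+_ to _+ℤ_)
open import Data.List using (length)
open import Data.Product using (_×_)
open import Relation.Binary.PropositionalEquality using (_≡_; _≢_)

theorem1 : (r : ℕ) → 3 ≤ r → (F : FiniteField) → length (FiniteField.elements F) ≡ 2 ^ r →
    (s : ℕ) → 1 ≤ s →
    ((h : ℕ) → 1 ≤ h → FF.MK F r (2 ^ s ∸ 1) h ≡ FF.mkRHS F r s h)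
    × ((j : ℕ) → FF.Cw F (2 ^ s ∸ 1) j ≡ FF.CwFormula F (2 ^ s ∸ 1) j)
    × (2 ^ r * FF.δ F (2 ^ s ∸ 1) (FiniteField.0# F) ≡ (2 ^ r ∸ 1) ^ (2 ^ s ∸ 1) + 1)
    × ((β : FiniteField.Carrier F) → β ≢ FiniteField.0# F →
        + (2 ^ r * FF.δ F (2 ^ s ∸ 1) β)
          ≡ + (2 ^ r) *ℤ FF.K F r (2 ^ s ∸ 2) (FiniteField._⁻¹ F β) +ℤ + ((2 ^ r ∸ 1) ^ (2 ^ s ∸ 1) + 1))
theorem1 r@(suc k) _ F card s 1≤s =
    MK≡mkRHS s
  , Cw≡CwFormula (2 ^ s ∸ 1)
  , δ-zero (2 ^ s ∸ 1) s 1≤s (trans (cong suc (sym n∸2+1)) n∸2+2)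
  -- `δ-nonzero` speaks of dimension `suc m`, so the result is transported from `suc (2 ^ s ∸ 2)` to
  -- `2 ^ s ∸ 1`.
  , λ β β≢0 → subst (λ m → + (2 ^ r * FF.δ F m β) ≡ + (2 ^ r) *ℤ FF.K F r (2 ^ s ∸ 2) (FiniteField._⁻¹ F β) +ℤ + ((2 ^ r ∸ 1) ^ m + 1))
      n∸2+1 (δ-nonzero (2 ^ s ∸ 2) s 1≤s n∸2+2 β≢0)
  where
  open CharacterSums F r k refl card
  open WeightDistribution F
  open Moments F r k refl card
  -- From s ≥ 1 follows 2 ≤ 2^s, so the truncated subtractions lose nothing.
  n∸2+2 : suc (suc (2 ^ s ∸ 2)) ≡ 2 ^ s
  n∸2+2 = ℕₚ.m+[n∸m]≡n (ℕₚ.^-monoʳ-≤ 2 1≤s)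
  n∸2+1 : suc (2 ^ s ∸ 2) ≡ 2 ^ s ∸ 1
  n∸2+1 = cong ℕ.pred n∸2+2
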